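{- Let $(\mathcal{G},X)$ be a pseudogroup of computable transformations defined on $X=\mathbb{N}$ which does not satisfy F\o lner's condition. Then $X$ has an effective paradoxical $\mathcal{G}$-decomposition.
   Context: A pseudogroup $\mathcal{G}$ of transformations of a set $X$ is a set of bijections $\rho:S\to T$ between subsets $S,T\subseteq X$ such that: (i) the identity $\mathrm{id}_X$ is in $\mathcal{G}$; (ii) if $\rho:S\to T$ is in $\mathcal{G}$, so is the inverse $\rho^{ -1}:T\to S$; (iii) if $\rho_1:S\to T$ and $\rho_2:T\to U$ are in $\mathcal{G}$, so is their composition $\rho_2\circ\rho_1:S\to U$; (iv) if $\rho:S\to T$ is in $\mathcal{G}$ and $S_0$ is a subset of $S$, then the restriction $\rho|S_0$ is in $\mathcal{G}$; (v) if $\rho:S\to T$ is a bijection between two subsets $S,T$ of $X$ and there exists a finite partition $S=\bigcup_{j\le n}S_j$ with $\rho|S_j\in\mathcal{G}$ for $j\in\{1,\dots,n\}$, then $\rho$ is in $\mathcal{G}$. For $\gamma:S\to T$ in $\mathcal{G}$, write $\alpha(\gamma)=S$ for its domain and $\omega(\gamma)=T$ for its range. With $X$ identified with $\mathbb{N}$, a transformation $\rho:S\to T$ from $\mathcal{G}$ is computable if $S$ and $T$ are computable subsets of $\mathbb{N}$ and $\rho$ is a computable function. For $R\subset\mathcal{G}$ and $A\subset X$, put $R^{ -1}=\{\rho^{ -1}:\rho\in R\}$ and $$\partial_R A=\{x\in X\setminus A:\ \exists\rho\in R\cup R^{ -1}\ (x\in\alpha(\rho)\text{ and }\rho(x)\in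 A)\}.$$ $\mathcal{G}$ satisfies F\o lner's condition if for any finite subset $R$ of $\mathcal{G}$ and any natural number $n$ there exists a finite non-empty subset $F$ of $X$ such that $|\partial_R F|<\frac1n|F|$. An effective paradoxical $\mathcal{G}$-decomposition of $X=\mathbb{N}$ is a tuple $(X_1,X_2,\gamma_1,\gamma_2)$ consisting of a non-trivial partition $X=X_1\sqcup X_2$ into computable sets and computable $\gamma_i\in\mathcal{G}$ with $\alpha(\gamma_i)=X_i$ and $\omega(\gamma_i)=X$ for $i=1,2$.
   Formalization: Axiom (iv) of a pseudogroup is required only for computable subsets S_0 of the domain; for arbitrary S_0 it would put the identity restricted to a non-computable set into G, contradicting that all transformations in G are computable. -}

module Defs where

open import Data.Fin.Base using (Fin)
open import Data.List.Base using (List; _++_; map)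
open import Data.List.Membership.Propositional using () renaming (_∈_ to _∈ˡ_)
open import Data.List.Relation.Unary.All using (All)
open import Data.Nat.Base using (ℕ; zero; suc; _*_; _<_; NonZero)
open import Data.Product.Base using (Σ; Σ-syntax; ∃; ∃-syntax; _×_; _,_; proj₁; proj₂)
open import Data.Sum.Base using (_⊎_)
open import Data.Vec.Base using (Vec; []; _∷_; lookup)
open import Data.Vec.Relation.Binary.Pointwise.Inductive using (Pointwise)
open import Function.Bundles using (Bijection)
open import Function.Properties.Bijection using (Bijection⇒Inverse) renaming (refl to id-bijection; trans to _then_)
open import Function.Properties.Inverse using (Inverse⇒Bijection) renaming (sym to flip-inverse)
open import Level using (Level; 0ℓ; _⊔_) renaming (suc to lsuc)
open import Relation.Binary.Bundles using (Setoid)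
open import Relation.Binary.PropositionalEquality using (_≡_; refl; setoid)
import Relation.Binary.Construct.On as On
open import Relation.Unary using (Pred; U; _∈_; _∉_; _⊆_; _≐_; _∪_; _⊥_; Satisfiable; Universal)

private variable
  a ℓ : Level
  k m n x y : ℕ

data Code : ℕ → Set where
  zeroᶜ : Code 0
  sucᶜ  : Code 1
  proj  : Fin n → Code n
  comp  : Code m → Vec (Code n) m → Code n
  prec  : Code n → Code (suc (suc n)) → Code (suc n)
  mu    : Code (suc n) → Code n

infix 4 _[_]↓_

-- Partial recursive functions: e [ xs ]↓ y means that the partial function coded
-- by e is defined at xs, with value y.
data _[_]↓_ : Code n → Vec ℕ n → ℕ → Set where
  ↓zero  : zeroᶜ [ [] ]↓ 0
  ↓suc   : sucᶜ [ x ∷ [] ]↓ suc x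
  ↓proj  : ∀ {xs : Vec ℕ n} {i} → proj i [ xs ]↓ lookup xs i
  ↓comp  : ∀ {f : Code m} {gs : Vec (Code n) m} {xs ys} →
           Pointwise (λ g z → g [ xs ]↓ z) gs ys → f [ ys ]↓ y →
           comp f gs [ xs ]↓ y
  ↓prec₀ : ∀ {f : Code n} {g xs} →
           f [ xs ]↓ y → prec f g [ 0 ∷ xs ]↓ y
  ↓precₛ : ∀ {f : Code n} {g xs} →
           prec f g [ k ∷ xs ]↓ x → g [ k ∷ x ∷ xs ]↓ y →
           prec f g [ suc k ∷ xs ]↓ y
  ↓mu    : ∀ {f : Code (suc n)} {xs} →
           f [ y ∷ xs ]↓ 0 →
           (∀ z → z < y → ∃[ w ] f [ z ∷ xs ]↓ suc w) →
           mu f [ xs ]↓ y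

ComputableSet : Pred (Pred ℕ a) a
ComputableSet S = Σ[ e ∈ Code 1 ] ∀ x →
  (x ∈ S × e [ x ∷ [] ]↓ 1) ⊎ (x ∉ S × e [ x ∷ [] ]↓ 0)

-- Elements of the subset, compared only by their underlying numbers, so that
-- maps between subsets cannot depend on membership proofs.
⟪_⟫ : Pred ℕ a → Setoid a 0ℓ
⟪ S ⟫ = On.setoid {B = Σ ℕ S} (setoid ℕ) proj₁

record Transformation : Set₁ where
  constructor mk
  field
    {α} : Pred ℕ 0ℓ
    {ω} : Pred ℕ 0ℓ
    bij : Bijection ⟪ α ⟫ ⟪ ω ⟫

  apply : ∀ x → x ∈ α → ℕ
  apply x x∈α = proj₁ (Bijection.to bij (x , x∈α))

open Transformation

infix 4 _≈_

record _≈_ (ρ σ : Transformation) : Set where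
  field
    α-≐   : α ρ ≐ α σ
    ω-≐   : ω ρ ≐ ω σ
    agree : ∀ x p q → apply ρ x p ≡ apply σ x q

identity : Transformation
identity = mk {U} {U} id-bijection

infix 8 _⁻¹

_⁻¹ : Transformation → Transformation
ρ ⁻¹ = mk (Inverse⇒Bijection (flip-inverse (Bijection⇒Inverse (bij ρ))))

restrict : (ρ : Transformation) (S₀ : Pred ℕ 0ℓ) → S₀ ⊆ α ρ → Transformation
restrict ρ S₀ S₀⊆α = mk
  {α = S₀}
  {ω = λ y → Σ[ x ∈ ℕ ] Σ[ p ∈ x ∈ S₀ ] apply ρ x (S₀⊆α p) ≡ y}
  record
    { to        = λ (x , p) → apply ρ x (S₀⊆α p) , x , p , refl
    ; cong      = Bijection.cong (bij ρ)
    ; bijective = Bijection.injective (bij ρ)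
                , λ { (_ , x , p , refl) → (x , p) , Bijection.cong (bij ρ) }
    }

-- The value of e off α ρ is irrelevant: α ρ is computable, so e can be cut down
-- to a partial recursive function with domain exactly α ρ.
ComputableTransformation : Pred Transformation 0ℓ
ComputableTransformation ρ =
  ComputableSet (α ρ) × ComputableSet (ω ρ) ×
  Σ[ e ∈ Code 1 ] ∀ x (p : x ∈ α ρ) → e [ x ∷ [] ]↓ apply ρ x p

record IsPartition (S : Pred ℕ 0ℓ) (P : Fin n → Pred ℕ 0ℓ) : Set where
  field
    part⊆    : ∀ j → P j ⊆ S
    covers   : ∀ {x} → x ∈ S → ∃[ j ] x ∈ P j
    disjoint : ∀ {x i j} → x ∈ P i → x ∈ P j → i ≡ j

-- A transformation is a set of pairs, so membership in 𝒢 must respect _≈_.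
--
-- Restrictions are taken to the subsets belonging to 𝒮.  A pseudogroup all of
-- whose members are computable has to be read with 𝒮 = ComputableSet: closure
-- under restriction to arbitrary subsets would put the identity of every
-- non-computable set into 𝒢, so no such 𝒢 would exist.
record IsPseudogroup (𝒮 : Pred (Pred ℕ 0ℓ) 0ℓ) (𝒢 : Pred Transformation ℓ) :
                     Set (lsuc 0ℓ ⊔ ℓ) where
  field
    respects-≈   : ∀ {ρ σ} → ρ ≈ σ → ρ ∈ 𝒢 → σ ∈ 𝒢
    identity∈    : identity ∈ 𝒢
    inverse∈     : ∀ {ρ} → ρ ∈ 𝒢 → ρ ⁻¹ ∈ 𝒢
    composition∈ : ∀ {S T V} (ρ₁ : Bijection ⟪ S ⟫ ⟪ T ⟫) (ρ₂ : Bijection ⟪ T ⟫ ⟪ V ⟫) →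
                   mk ρ₁ ∈ 𝒢 → mk ρ₂ ∈ 𝒢 → mk (ρ₁ then ρ₂) ∈ 𝒢
    restriction∈ : ∀ {ρ} → ρ ∈ 𝒢 → ∀ {S₀} → S₀ ∈ 𝒮 → (S₀⊆α : S₀ ⊆ α ρ) →
                   restrict ρ S₀ S₀⊆α ∈ 𝒢
    gluing∈      : ∀ ρ {n} {P : Fin n → Pred ℕ 0ℓ} (part : IsPartition (α ρ) P) →
                   (∀ j → restrict ρ (P j) (IsPartition.part⊆ part j) ∈ 𝒢) →
                   ρ ∈ 𝒢

record IsPseudogroupOfComputableTransformations (𝒢 : Pred Transformation ℓ) :
                                                Set (lsuc 0ℓ ⊔ ℓ) where
  field
    isPseudogroup : IsPseudogroup ComputableSet 𝒢
    computable    : 𝒢 ⊆ ComputableTransformation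

infix 4 ∣_∣≡_

∣_∣≡_ : Pred ℕ a → ℕ → Set a
∣ A ∣≡ k = Bijection (setoid (Fin k)) ⟪ A ⟫

∂ : List Transformation → Pred ℕ 0ℓ → Pred ℕ (lsuc 0ℓ)
∂ R A x = x ∉ A ×
  (∃[ ρ ] ρ ∈ˡ R ++ map _⁻¹ R × (Σ[ p ∈ x ∈ α ρ ] apply ρ x p ∈ A))

-- n * b < k is ∣∂ R F∣ < (1/n) ∣F∣ with denominators cleared.
Følner : Pred Transformation ℓ → Set (lsuc 0ℓ ⊔ ℓ)
Følner 𝒢 = ∀ (R : List Transformation) → All (_∈ 𝒢) R → ∀ n → .{{NonZero n}} →
  Σ[ F ∈ Pred ℕ 0ℓ ] Satisfiable F ×
  (∃[ k ] ∃[ b ] ∣ F ∣≡ k × ∣ ∂ R F ∣≡ b × n * b < k)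

record EffectiveParadoxicalDecomposition (𝒢 : Pred Transformation ℓ) :
                                         Set (lsuc 0ℓ ⊔ ℓ) where
  field
    X₁ X₂           : Pred ℕ 0ℓ
    covers          : Universal (X₁ ∪ X₂)
    disjoint        : X₁ ⊥ X₂
    nonempty₁       : Satisfiable X₁
    nonempty₂       : Satisfiable X₂
    X₁-computable   : ComputableSet X₁
    X₂-computable   : ComputableSet X₂
    γ₁              : Bijection ⟪ X₁ ⟫ ⟪ U ⟫
    γ₂              : Bijection ⟪ X₂ ⟫ ⟪ U ⟫
    γ₁∈𝒢            : mk γ₁ ∈ 𝒢
    γ₂∈𝒢            : mk γ₂ ∈ 𝒢
    γ₁-computable   : ComputableTransformation (mk γ₁)
    γ₂-computable   : ComputableTransformation (mk γ₂)

{-# OPTIONS --safe #-}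
module Submission where

-- Failure of Følner's condition gives, after iteration, a finite symmetric set of elements of 𝒢
-- whose graph expands finite sets at least fourfold.  Two copies of each target against one copy of
-- each source then form a locally finite bipartite graph in which every finite set on one side
-- has at least twice as many neighbours, and a computable perfect matching of it is a decomposition.
--
-- The matching is found greedily (Kierstead's effective Hall theorem).  If a partial matching of
-- [0,n) extends to [0,horizon n), where horizon n bounds the ball of radius about 4n around [0,n),
-- then it extends to every [0,p): Hall's condition survives the removal of the at most 2n matched
-- vertices, for sets of size ≥ 2n by expansion, and for smaller ones since they miss one of
-- 2n layers, inside which the given extension provides neighbours and outside which nothing was
-- removed.  So it suffices to search, at each stage n, for an extension up to horizon n.

open import Defs
open import Axiom.ExcludedMiddle using (ExcludedMiddle)
open import Data.Bool.Base using (Bool; true; false)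
open import Data.Empty using (⊥; ⊥-elim)
open import Data.Fin.Base using (Fin; zero; suc)
open import Data.Fin.Patterns using (0F; 1F; 2F; 3F)
open import Data.List.Base as List using (List; []; _∷_; _++_; map; length; filter; upTo; cartesianProductWith; deduplicate)
open import Data.List.Membership.Propositional using (find; lose) renaming (_∈_ to _∈ˡ_; _∉_ to _∉ˡ_)
open import Data.List.Membership.Propositional.Properties
open import Data.List.Properties using (length-map; length-++; length-++-sucʳ; length-upTo; filter-notAll)
open import Data.List.Relation.Unary.All as All using (All; []; _∷_)
import Data.List.Relation.Unary.All.Properties as All
open import Data.List.Relation.Unary.AllPairs using ([]; _∷_)
open import Data.List.Relation.Unary.Any as Any using (here; there)
open import Data.List.Relation.Unary.Any.Properties using (lookup-index)
open import Data.List.Relation.Unary.Unique.Propositional using (Unique)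
import Data.List.Relation.Unary.Unique.Propositional.Properties as Unique
open import Data.Nat.Base using (ℕ; zero; suc; pred; _+_; _*_; _∸_; _<_; _≤_; z≤n; s≤s; z<s; s<s; NonZero)
open import Data.Nat.Divisibility using (divides-refl)
open import Data.Nat.DivMod using (_/_; _%_; m≡m%n+[m/n]*n; m%n<n; m/n*n≤m; m/n≤m; [m+kn]%n≡m%n; +-distrib-/-∣ʳ; m<n⇒m%n≡m; m<n⇒m/n≡0; m*n/n≡m)
open import Data.Nat.Properties
open import Data.Product.Base using (Σ; Σ-syntax; ∃-syntax; _×_; _,_; proj₁; proj₂)
open import Data.Sum.Base using (_⊎_; inj₁; inj₂; [_,_]′)
open import Data.Unit.Base using (tt)
open import Data.Vec.Base using (Vec; []; _∷_; lookup; head; tail; tabulate)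
open import Data.Vec.Relation.Binary.Pointwise.Inductive using (Pointwise; []; _∷_)
open import Function.Base using (_∘_; id)
open import Function.Bundles using (Bijection; Inverse)
open import Function.Properties.Bijection using (Bijection⇒Inverse) renaming (trans to _then_)
open import Level using (Level; Lift; lift; lower; 0ℓ; _⊔_) renaming (suc to lsuc)
open import Relation.Binary.PropositionalEquality using (_≡_; _≢_; refl; sym; trans; cong; cong₂; subst; module ≡-Reasoning)
open import Relation.Nullary using (¬_; Dec; yes; no; ¬?; does)
open import Relation.Nullary.Decidable using (dec-true; dec-false)
open import Relation.Unary using (Pred; Decidable; _∈_; _∉_; U; Satisfiable)

open import Data.List.Relation.Unary.Unique.DecPropositional.Properties _≟_ using (deduplicate-!)

open Transformation

private variable
  m n : ℕ

-- Computable functions and decidable predicates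

Comp : (Vec ℕ n → ℕ) → Set
Comp {n} f = Σ[ e ∈ Code n ] ∀ xs → e [ xs ]↓ f xs

Comp₁ : (ℕ → ℕ) → Set
Comp₁ f = Comp {1} λ v → f (lookup v 0F)

Comp₂ : (ℕ → ℕ → ℕ) → Set
Comp₂ f = Comp {2} λ v → f (lookup v 0F) (lookup v 1F)

comp-ext : {f g : Vec ℕ n → ℕ} → (∀ xs → f xs ≡ g xs) → Comp f → Comp g
comp-ext f≗g (e , p) = e , λ xs → subst (e [ xs ]↓_) (f≗g xs) (p xs)

var : (i : Fin n) → Comp λ xs → lookup xs i
var i = proj i , λ xs → ↓proj

ap₁ : ∀ f {g : Vec ℕ n → ℕ} → Comp₁ f → Comp g → Comp λ xs → f (g xs)
ap₁ _ (e , p) (d , q) = comp e (d ∷ []) , λ xs → ↓comp (q xs ∷ []) (p _)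

ap₂ : ∀ f {g h : Vec ℕ n → ℕ} → Comp₂ f → Comp g → Comp h → Comp λ xs → f (g xs) (h xs)
ap₂ _ (e , p) (d , q) (d′ , q′) =
  comp e (d ∷ d′ ∷ []) , λ xs → ↓comp (q xs ∷ q′ xs ∷ []) (p _)

-- The renaming `ρ` lets the recursion on `xs` shift indices while `env` stays fixed. The uses are
-- `id` and a shift by two, for passing parameters on unchanged.
projections : ∀ {env : Vec ℕ m} (xs : Vec ℕ n) (ρ : Fin n → Fin m) →
              (∀ i → lookup env (ρ i) ≡ lookup xs i) →
              Pointwise (λ g z → g [ env ]↓ z) (tabulate (proj ∘ ρ)) xs
projections []       ρ eq = []
projections {env = env} (x ∷ xs) ρ eq =
  subst (proj _ [ env ]↓_) (eq zero) ↓proj ∷ projections xs (ρ ∘ suc) (eq ∘ suc)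

instantiate : {f : Vec ℕ (suc n) → ℕ} {b : Vec ℕ n → ℕ} →
              Comp f → Comp b → Comp λ xs → f (b xs ∷ xs)
instantiate (e , p) (d , q) =
  comp e (d ∷ tabulate proj) ,
  λ xs → ↓comp (q xs ∷ projections xs id (λ _ → refl)) (p _)

skip₁ : {f : Vec ℕ (suc n) → ℕ} → Comp f → Comp {suc (suc n)} λ v → f (head v ∷ tail (tail v))
skip₁ (e , p) =
  comp e (proj zero ∷ tabulate λ i → proj (suc (suc i))) ,
  λ { (k ∷ x ∷ xs) → ↓comp (↓proj ∷ projections xs (λ i → suc (suc i)) (λ _ → refl)) (p _) }

rec : {f : Vec ℕ n → ℕ} {g : Vec ℕ (suc (suc n)) → ℕ} {h : ℕ → Vec ℕ n → ℕ} →
      Comp f → Comp g →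
      (∀ xs → f xs ≡ h 0 xs) → (∀ k xs → g (k ∷ h k xs ∷ xs) ≡ h (suc k) xs) →
      Comp {suc n} λ v → h (head v) (tail v)
rec {f = f} {g} {h} (e , p) (d , q) eq₀ eqₛ = prec e d , λ { (k ∷ xs) → run k xs }
  where
  run : ∀ k xs → prec e d [ k ∷ xs ]↓ h k xs
  run zero    xs = subst (prec e d [ 0 ∷ xs ]↓_) (eq₀ xs) (↓prec₀ (p xs))
  run (suc k) xs =
    subst (prec e d [ suc k ∷ xs ]↓_) (eqₛ k xs) (↓precₛ (run k xs) (q _))

const-zero : Comp {n} λ _ → 0
const-zero = comp zeroᶜ [] , λ xs → ↓comp [] ↓zero

suc-comp : Comp₁ suc
suc-comp = sucᶜ , λ { (x ∷ []) → ↓suc }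

const-comp : ∀ c → Comp {n} λ _ → c
const-comp zero    = const-zero
const-comp (suc c) = ap₁ suc suc-comp (const-comp c)

+-comp : Comp₂ _+_
+-comp = comp-ext (λ { (x ∷ y ∷ []) → refl })
  (rec {h = λ k xs → k + lookup xs 0F} (var 0F) (ap₁ suc suc-comp (var 1F))
       (λ _ → refl) (λ _ _ → refl))

*-comp : Comp₂ _*_
*-comp = comp-ext (λ { (x ∷ y ∷ []) → refl })
  (rec {h = λ k xs → k * lookup xs 0F} const-zero (ap₂ _+_ +-comp (var 2F) (var 1F))
       (λ _ → refl) (λ _ _ → refl))

pred-comp : Comp₁ pred
pred-comp = comp-ext (λ { (x ∷ []) → refl })
  (rec {h = λ k _ → pred k} const-zero (var 0F) (λ _ → refl) (λ _ _ → refl))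

∸-comp : Comp₂ _∸_
∸-comp = comp-ext (λ { (x ∷ y ∷ []) → refl })
  -- `prec` recurses on the first argument, truncated subtraction here on the second, so the
  -- arguments are swapped.
  (ap₂ (λ x y → y ∸ x) (comp-ext {g = λ v → lookup v 1F ∸ lookup v 0F} (λ { (x ∷ y ∷ []) → refl })
    (rec {h = λ k xs → lookup xs 0F ∸ k} (var 0F) (ap₁ pred pred-comp (var 1F))
         (λ _ → refl) (λ k xs → pred[m∸n]≡m∸[1+n] (lookup xs 0F) k)))
    (var 1F) (var 0F))

-- Serves two purposes: a bounded universal statement is the vanishing of such a sum, and the sum of
-- the successors of values is a strict bound for each of them.
sum< : (ℕ → ℕ) → ℕ → ℕ
sum< f zero    = 0
sum< f (suc k) = f k + sum< f k

sum<-comp : {f : Vec ℕ (suc n) → ℕ} → Comp f → Comp {suc n} λ v → sum< (λ i → f (i ∷ tail v)) (head v)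
sum<-comp {f = f} F = comp-ext (λ { (k ∷ xs) → refl })
  (rec {h = λ k xs → sum< (λ i → f (i ∷ xs)) k} const-zero
       (ap₂ _+_ +-comp (skip₁ F) (var 1F)) (λ _ → refl) (λ _ _ → refl))

f≤sum< : ∀ f {i k} → i < k → f i ≤ sum< f k
f≤sum< f {i} {suc k} i<1+k with m≤n⇒m<n∨m≡n (≤-pred i<1+k)
... | inj₁ i<k  = ≤-trans (f≤sum< f i<k) (m≤n+m _ (f k))
... | inj₂ refl = m≤m+n (f k) _

sum<≡0 : ∀ f k → (∀ i → i < k → f i ≡ 0) → sum< f k ≡ 0
sum<≡0 f zero    _ = refl
sum<≡0 f (suc k) z rewrite z k (n<1+n k) = sum<≡0 f k λ i i<k → z i (m<n⇒m<1+n i<k)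

-- Truth is represented by the value 0, so that conjunction is addition and
-- minimisation searches for a solution.
DecC : (Vec ℕ n → Set) → Set
DecC {n} P = Σ[ f ∈ (Vec ℕ n → ℕ) ] Comp f × (∀ xs → (f xs ≡ 0 → P xs) × (P xs → f xs ≡ 0))

DecC₁ : (ℕ → Set) → Set
DecC₁ P = DecC {1} λ v → P (lookup v 0F)

DecC₂ : (ℕ → ℕ → Set) → Set
DecC₂ P = DecC {2} λ v → P (lookup v 0F) (lookup v 1F)

decC-ext : {P Q : Vec ℕ n → Set} → (∀ xs → P xs → Q xs) → (∀ xs → Q xs → P xs) → DecC P → DecC Q
decC-ext to from (f , F , p) = f , F , λ xs → to xs ∘ proj₁ (p xs) , proj₂ (p xs) ∘ from xs

decC⇒Dec : {P : Vec ℕ n → Set} → DecC P → ∀ xs → Dec (P xs)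
decC⇒Dec (f , _ , p) xs with f xs ≟ 0
... | yes z = yes (proj₁ (p xs) z)
... | no ¬z = no (¬z ∘ proj₂ (p xs))

decC-ap₁ : ∀ P {g : Vec ℕ n → ℕ} → DecC₁ P → Comp g → DecC λ xs → P (g xs)
decC-ap₁ _ (f , F , p) G = (λ xs → f (_ ∷ [])) , ap F , λ xs → p _
  where
  ap : ∀ {f : Vec ℕ 1 → ℕ} → Comp f → Comp λ xs → f (_ ∷ [])
  ap (e , q) = comp e (proj₁ G ∷ []) , λ xs → ↓comp (proj₂ G xs ∷ []) (q _)

decC-ap₂ : ∀ P {g h : Vec ℕ n → ℕ} → DecC₂ P → Comp g → Comp h → DecC λ xs → P (g xs) (h xs)
decC-ap₂ _ (f , (e , q) , p) G H =
  (λ xs → f (_ ∷ _ ∷ [])) ,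
  (comp e (proj₁ G ∷ proj₁ H ∷ []) , λ xs → ↓comp (proj₂ G xs ∷ proj₂ H xs ∷ []) (q _)) ,
  λ xs → p _

infixr 3 _×ᶜ_
infixr 2 _⊎ᶜ_
infixr 1 _→ᶜ_
infix  4 _≡ᶜ_ _<ᶜ_

_×ᶜ_ : {P Q : Vec ℕ n → Set} → DecC P → DecC Q → DecC λ xs → P xs × Q xs
(f , F , p) ×ᶜ (g , G , q) = (λ xs → f xs + g xs) , ap₂ _+_ +-comp F G , λ xs →
  (λ z → proj₁ (p xs) (m+n≡0⇒m≡0 (f xs) z) , proj₁ (q xs) (m+n≡0⇒n≡0 (f xs) z)) ,
  λ (x , y) → trans (cong (_+ g xs) (proj₂ (p xs) x)) (proj₂ (q xs) y)

_⊎ᶜ_ : {P Q : Vec ℕ n → Set} → DecC P → DecC Q → DecC λ xs → P xs ⊎ Q xs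
_⊎ᶜ_ {P = P} {Q} (f , F , p) (g , G , q) =
  (λ xs → f xs * g xs) , ap₂ _*_ *-comp F G , λ xs → to xs , from xs
  where
  to : ∀ xs → f xs * g xs ≡ 0 → P xs ⊎ Q xs
  to xs z with m*n≡0⇒m≡0∨n≡0 (f xs) z
  ... | inj₁ z₁ = inj₁ (proj₁ (p xs) z₁)
  ... | inj₂ z₂ = inj₂ (proj₁ (q xs) z₂)
  from : ∀ xs → P xs ⊎ Q xs → f xs * g xs ≡ 0
  from xs (inj₁ x) = cong (_* g xs) (proj₂ (p xs) x)
  from xs (inj₂ y) = trans (cong (f xs *_) (proj₂ (q xs) y)) (*-zeroʳ (f xs))

¬ᶜ_ : {P : Vec ℕ n → Set} → DecC P → DecC λ xs → ¬ P xs
¬ᶜ_ {P = P} (f , F , p) = (λ xs → 1 ∸ f xs) , ap₂ _∸_ ∸-comp (const-comp 1) F , λ xs → to xs , from xs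
  where
  to : ∀ xs → 1 ∸ f xs ≡ 0 → ¬ P xs
  to xs z x with f xs | proj₂ (p xs) x
  to xs () x | .0 | refl
  from : ∀ xs → ¬ P xs → 1 ∸ f xs ≡ 0
  from xs ¬x with f xs | proj₁ (p xs)
  ... | zero  | w = ⊥-elim (¬x (w refl))
  ... | suc k | _ = 0∸n≡0 k

_→ᶜ_ : {P Q : Vec ℕ n → Set} → DecC P → DecC Q → DecC λ xs → P xs → Q xs
_→ᶜ_ {P = P} {Q} p q = decC-ext (λ xs → λ { (inj₁ ¬x) x → ⊥-elim (¬x x) ; (inj₂ y) _ → y }) from (¬ᶜ p ⊎ᶜ q)
  where
  from : ∀ xs → (P xs → Q xs) → ¬ P xs ⊎ Q xs
  from xs i with decC⇒Dec p xs
  ... | yes x = inj₂ (i x)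
  ... | no ¬x = inj₁ ¬x

_<ᶜ_ : {f g : Vec ℕ n → ℕ} → Comp f → Comp g → DecC λ xs → f xs < g xs
_<ᶜ_ {f = f} {g} F G = (λ xs → suc (f xs) ∸ g xs) , ap₂ _∸_ ∸-comp (ap₁ suc suc-comp F) G ,
  λ xs → m∸n≡0⇒m≤n , m≤n⇒m∸n≡0

_≡ᶜ_ : {f g : Vec ℕ n → ℕ} → Comp f → Comp g → DecC λ xs → f xs ≡ g xs
_≡ᶜ_ {f = f} {g} F G =
  decC-ext (λ xs (p , q) → ≤-antisym (≮⇒≥ q) (≮⇒≥ p))
           (λ xs eq → (λ lt → <-irrefl eq lt) , (λ gt → <-irrefl (sym eq) gt))
           (¬ᶜ (F <ᶜ G) ×ᶜ ¬ᶜ (G <ᶜ F))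

∀<ᶜ : {P : Vec ℕ (suc n) → Set} {b : Vec ℕ n → ℕ} → Comp b → DecC P →
      DecC λ xs → ∀ i → i < b xs → P (i ∷ xs)
∀<ᶜ {b = b} B (f , F , p) =
  (λ xs → sum< (λ i → f (i ∷ xs)) (b xs)) , instantiate (sum<-comp F) B , λ xs →
  (λ z i i<b → proj₁ (p _) (n≤0⇒n≡0 (subst (f (i ∷ xs) ≤_) z (f≤sum< (λ i → f (i ∷ xs)) i<b)))) ,
  λ h → sum<≡0 _ (b xs) λ i i<b → proj₂ (p _) (h i i<b)

-- The last component has the shape of the second premise of `↓mu`. The known zero `k` only bounds
-- the recursion.
least : (f : ℕ → ℕ) → ∀ k → f k ≡ 0 → Σ[ y ∈ ℕ ] f y ≡ 0 × (∀ z → z < y → ∃[ w ] f z ≡ suc w)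
least f zero    z = 0 , z , λ _ ()
least f (suc k) z with f 0 in eq
... | zero  = 0 , eq , λ _ ()
... | suc w with least (f ∘ suc) k z
...   | y , fy , below = suc y , fy , λ { zero _ → w , eq ; (suc i) (s<s i<y) → below i i<y }

abstract
  -- The existence proof only guarantees termination and leaves no trace in the code `mu e`. It may
  -- therefore rest on excluded middle, and the function found is computable all the same.
  search : {P : Vec ℕ (suc n) → Set} → DecC P → (∀ xs → ∃[ y ] P (y ∷ xs)) →
           Σ[ h ∈ (Vec ℕ n → ℕ) ] Comp h × (∀ xs → P (h xs ∷ xs)) × (∀ xs z → z < h xs → ¬ P (z ∷ xs))
  search {n} {P} (f , (e , q) , p) ex =
    proj₁ ∘ lst , (mu e , run) ,
    (λ xs → proj₁ (p _) (proj₁ (proj₂ (lst xs)))) ,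
    λ xs z z< Pz → 0≢1+n (trans (sym (proj₂ (p _) Pz)) (proj₂ (proj₂ (proj₂ (lst xs)) z z<)))
    where
    lst : (xs : Vec ℕ n) → Σ[ y ∈ ℕ ] f (y ∷ xs) ≡ 0 × (∀ z → z < y → ∃[ w ] f (z ∷ xs) ≡ suc w)
    lst xs = let (y , Py) = ex xs in least (λ y → f (y ∷ xs)) y (proj₂ (p _) Py)
    run : ∀ xs → mu e [ xs ]↓ proj₁ (lst xs)
    run xs with lst xs
    ... | y , fy , below = ↓mu (subst (e [ y ∷ xs ]↓_) fy (q _))
      λ z z<y → let (w , eq) = below z z<y in w , subst (e [ z ∷ xs ]↓_) eq (q _)

decC⇒ComputableSet : ∀ {S} → DecC₁ S → ComputableSet S
decC⇒ComputableSet {S} (f , F , p) = proj₁ χ , λ x → decide x (decC⇒Dec (f , F , p) (x ∷ []))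
  where
  χ : Comp {1} λ v → 1 ∸ f v
  χ = ap₂ _∸_ ∸-comp (const-comp 1) F
  off : ∀ k → k ≢ 0 → 1 ∸ k ≡ 0
  off zero    z = ⊥-elim (z refl)
  off (suc k) _ = 0∸n≡0 k
  decide : ∀ x → Dec (S x) → (S x × proj₁ χ [ x ∷ [] ]↓ 1) ⊎ (¬ S x × proj₁ χ [ x ∷ [] ]↓ 0)
  decide x (yes x∈S) = inj₁ (x∈S , subst (proj₁ χ [ x ∷ [] ]↓_) (cong (1 ∸_) (proj₂ (p _) x∈S)) (proj₂ χ _))
  decide x (no  x∉S) = inj₂ (x∉S , subst (proj₁ χ [ x ∷ [] ]↓_) (off _ (x∉S ∘ proj₁ (p _))) (proj₂ χ _))

ComputableSet⇒decC : ∀ {S} → ComputableSet S → DecC₁ S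
ComputableSet⇒decC {S} (e , q) =
  decC-ext {P = λ v → χ (lookup v 0F) ≡ 1} (λ v → to _) (λ v → from _) (ap₁ χ χ-comp (var 0F) ≡ᶜ const-comp 1)
  where
  χ : ℕ → ℕ
  χ x with q x
  ... | inj₁ _ = 1
  ... | inj₂ _ = 0
  run : ∀ x → e [ x ∷ [] ]↓ χ x
  run x with q x
  ... | inj₁ (_ , r) = r
  ... | inj₂ (_ , r) = r
  χ-comp : Comp₁ χ
  χ-comp = e , λ { (x ∷ []) → run x }
  to : ∀ x → χ x ≡ 1 → S x
  to x eq with q x
  to x eq | inj₁ (x∈S , _) = x∈S
  to x () | inj₂ _
  from : ∀ x → S x → χ x ≡ 1
  from x x∈S with q x
  ... | inj₁ _ = refl
  ... | inj₂ (x∉S , _) = ⊥-elim (x∉S x∈S)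

-- Pairs are coded by (a , b) ↦ (a + b)² + a, and unpaired with the integer square root.
abstract
  √-search : Σ[ h ∈ (Vec ℕ 1 → ℕ) ] Comp h ×
             (∀ xs → lookup xs 0F < suc (h xs) * suc (h xs)) ×
             (∀ xs r → r < h xs → ¬ (lookup xs 0F < suc r * suc r))
  √-search = search {n = 1} {P = λ v → lookup v 1F < suc (lookup v 0F) * suc (lookup v 0F)}
    (var 1F <ᶜ ap₂ _*_ *-comp (ap₁ suc suc-comp (var 0F)) (ap₁ suc suc-comp (var 0F)))
    (λ xs → lookup xs 0F , m≤m*n (suc (lookup xs 0F)) (suc (lookup xs 0F)))

  √ : ℕ → ℕ
  √ s = proj₁ √-search (s ∷ [])

  √-comp : Comp₁ √
  √-comp = comp-ext (λ { (s ∷ []) → refl }) (proj₁ (proj₂ √-search))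

  <-√ : ∀ s → s < suc (√ s) * suc (√ s)
  <-√ s = proj₁ (proj₂ (proj₂ √-search)) (s ∷ [])

  √-least : ∀ s r → r < √ s → suc r * suc r ≤ s
  √-least s r r<√s = ≮⇒≥ (proj₂ (proj₂ (proj₂ √-search)) (s ∷ []) r r<√s)

√[k²+a]≡k : ∀ {a k} → a ≤ k → √ (k * k + a) ≡ k
√[k²+a]≡k {a} {k} a≤k = ≤-antisym (≮⇒≥ not>) (≮⇒≥ not<)
  where
  s = k * k + a
  s<[1+k]² : s < suc k * suc k
  s<[1+k]² = s≤s (begin
    k * k + a         ≤⟨ +-monoʳ-≤ (k * k) a≤k ⟩
    k * k + k         ≡⟨ trans (+-comm (k * k) k) (sym (*-suc k k)) ⟩
    k * suc k         ≤⟨ m≤n+m (k * suc k) k ⟩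
    k + k * suc k     ∎)
    where open ≤-Reasoning
  not> : ¬ (k < √ s)
  not> k<√s = <⇒≱ s<[1+k]² (√-least s k k<√s)
  not< : ¬ (√ s < k)
  not< √s<k = <⇒≱ (<-√ s) (≤-trans (*-mono-≤ √s<k √s<k) (m≤m+n (k * k) a))

pair : ℕ → ℕ → ℕ
pair a b = (a + b) * (a + b) + a

abstract
  fst snd : ℕ → ℕ
  fst s = s ∸ √ s * √ s
  snd s = √ s ∸ fst s

  fst-pair : ∀ a b → fst (pair a b) ≡ a
  fst-pair a b rewrite √[k²+a]≡k (m≤m+n a b) = m+n∸m≡n ((a + b) * (a + b)) a

  snd-pair : ∀ a b → snd (pair a b) ≡ b
  snd-pair a b = trans (cong₂ _∸_ (√[k²+a]≡k (m≤m+n a b)) (fst-pair a b)) (m+n∸m≡n a b)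

  fst-comp : Comp₁ fst
  fst-comp = ap₂ _∸_ ∸-comp (var 0F)
    (ap₂ _*_ *-comp (ap₁ √ √-comp (var 0F)) (ap₁ √ √-comp (var 0F)))

  snd-comp : Comp₁ snd
  snd-comp = ap₂ _∸_ ∸-comp (ap₁ √ √-comp (var 0F)) (ap₁ fst fst-comp (var 0F))

abstract
  -- A number codes a sequence as an iterated pair: entry `i` is the first component left after
  -- taking second components `i` times. By `at-surjective` every finite sequence has a code.
  drop : ℕ → ℕ → ℕ
  drop s zero    = s
  drop s (suc i) = snd (drop s i)

  at : ℕ → ℕ → ℕ
  at s i = fst (drop s i)

  drop-snd : ∀ s i → drop s (suc i) ≡ drop (snd s) i
  drop-snd s zero    = refl
  drop-snd s (suc i) = cong snd (drop-snd s i)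

  at-comp : Comp₂ at
  at-comp = ap₁ fst fst-comp (ap₂ (λ i s → drop s i)
    (comp-ext (λ { (i ∷ s ∷ []) → refl })
      (rec {h = λ i xs → drop (lookup xs 0F) i} (var 0F) (ap₁ snd snd-comp (var 1F))
           (λ _ → refl) (λ _ _ → refl)))
    (var 1F) (var 0F))

  at-surjective : ∀ m (f : ℕ → ℕ) → ∃[ s ] ∀ i → i < m → at s i ≡ f i
  at-surjective zero    f = 0 , λ _ ()
  at-surjective (suc m) f = pair (f 0) s , entries
    where
    s : ℕ
    s = proj₁ (at-surjective m (f ∘ suc))
    entries : ∀ i → i < suc m → at (pair (f 0) s) i ≡ f i
    entries zero    _         = fst-pair (f 0) s
    entries (suc i) (s<s i<m) =
      trans (cong fst (trans (drop-snd (pair (f 0) s) i) (cong (λ t → drop t i) (snd-pair (f 0) s))))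
            (proj₂ (at-surjective m (f ∘ suc)) i i<m)

-- Greedy construction of a computable matching

record PartialMatching (_~_ : ℕ → ℕ → Set) (m : ℕ) (c : ℕ → ℕ) : Set where
  field
    edge      : ∀ i → i < m → i ~ c i
    -- A partner may lie at or above `m`, where the values of `c` do not count. This condition is
    -- then silent, and `injective` keeps two vertices from sharing that partner.
    involutes : ∀ i → i < m → c i < m → c (c i) ≡ i
    injective : ∀ i → i < m → ∀ j → j < m → c i ≡ c j → i ≡ j

module GreedyMatching
  (_~_ : ℕ → ℕ → Set) (~-decC : DecC₂ _~_)
  where

  abstract
    partialMatching-decC : DecC₂ λ m s → PartialMatching _~_ m (at s)
    partialMatching-decC = decC-ext
      (λ v (e , n , j) → record { edge = e ; involutes = n ; injective = j })
      (λ v g → PartialMatching.edge g , PartialMatching.involutes g , PartialMatching.injective g)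
      (∀<ᶜ (var 0F) (decC-ap₂ _~_ ~-decC (var 0F) (ap₂ at at-comp (var 2F) (var 0F)))
       ×ᶜ
       ∀<ᶜ (var 0F) ((ap₂ at at-comp (var 2F) (var 0F) <ᶜ var 1F) →ᶜ
                     (ap₂ at at-comp (var 2F) (ap₂ at at-comp (var 2F) (var 0F)) ≡ᶜ var 0F))
       ×ᶜ
       ∀<ᶜ (var 0F) (∀<ᶜ (var 1F)
         ((ap₂ at at-comp (var 3F) (var 1F) ≡ᶜ ap₂ at at-comp (var 3F) (var 0F)) →ᶜ (var 1F ≡ᶜ var 0F))))

  partialMatching-ext : ∀ {m c d} → (∀ i → i < m → c i ≡ d i) → PartialMatching _~_ m c → PartialMatching _~_ m d
  partialMatching-ext {m} {c} {d} c≗d g = record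
    { edge = λ i i<m → subst (i ~_) (c≗d i i<m) (edge i i<m)
    ; involutes = λ i i<m di<m →
        let ci<m = subst (_< m) (sym (c≗d i i<m)) di<m in
        trans (cong d (sym (c≗d i i<m))) (trans (sym (c≗d (c i) ci<m)) (involutes i i<m ci<m))
    ; injective = λ i i<m j j<m eq →
        injective i i<m j j<m (trans (c≗d i i<m) (trans eq (sym (c≗d j j<m))))
    } where open PartialMatching g

  module Computation
    (horizon : ℕ → ℕ) (horizon-comp : Comp₁ horizon)
    (horizon₀ : horizon 0 ≡ 0) (n≤horizon : ∀ n → n ≤ horizon n)
    (extend : ∀ n c → PartialMatching _~_ (horizon n) c → ∀ p → ∃[ d ] PartialMatching _~_ p d × (∀ i → i < n → d i ≡ c i))
    where

    -- The premise makes the condition vacuous when `prev` codes no matching, so that a next state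
    -- exists for all arguments, as a total search demands.
    Next : ℕ → ℕ → ℕ → Set
    Next n prev s = PartialMatching _~_ (horizon n) (at prev) →
                    PartialMatching _~_ (horizon (suc n)) (at s) × (∀ i → i < n → at s i ≡ at prev i)

    next-exists : ∀ n prev → ∃[ s ] Next n prev s
    next-exists n prev with decC⇒Dec partialMatching-decC (horizon n ∷ prev ∷ [])
    ... | no  bad  = 0 , λ good → ⊥-elim (bad good)
    ... | yes good = s , λ _ →
      partialMatching-ext (λ i i<h → sym (s-codes i (m≤n⇒m≤n+o n i<h))) d-good ,
      λ i i<n → trans (s-codes i (m≤n⇒m≤o+n (horizon (suc n)) i<n)) (d≗ i i<n)
      where
      ex = extend n (at prev) good (horizon (suc n))
      d = proj₁ ex
      d-good = proj₁ (proj₂ ex)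
      d≗ = proj₂ (proj₂ ex)
      -- The length covers both ranges on which the code has to agree with `d`: below
      -- `horizon (suc n)` for the matching and below `n` for the agreement with `prev`.
      sq = at-surjective (horizon (suc n) + n) d
      s = proj₁ sq
      s-codes = proj₂ sq

    abstract
      next-search : Σ[ h ∈ (Vec ℕ 2 → ℕ) ] Comp h × (∀ xs → Next (lookup xs 0F) (lookup xs 1F) (h xs))
      next-search =
        let (h , H , next , _) = search {n = 2} {P = λ v → Next (lookup v 1F) (lookup v 2F) (lookup v 0F)}
              (partialMatchingᶜ (ap₁ horizon horizon-comp (var 1F)) (var 2F) →ᶜ
               partialMatchingᶜ (ap₁ horizon horizon-comp (ap₁ suc suc-comp (var 1F))) (var 0F) ×ᶜ
               ∀<ᶜ (var 1F) (ap₂ at at-comp (var 1F) (var 0F) ≡ᶜ ap₂ at at-comp (var 3F) (var 0F)))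
              (λ xs → next-exists (lookup xs 0F) (lookup xs 1F))
        in h , H , next
        where
        partialMatchingᶜ : ∀ {n} {g h : Vec ℕ n → ℕ} → Comp g → Comp h → DecC λ xs → PartialMatching _~_ (g xs) (at (h xs))
        partialMatchingᶜ = decC-ap₂ (λ m s → PartialMatching _~_ m (at s)) partialMatching-decC

    state : ℕ → ℕ
    state zero    = 0
    state (suc n) = proj₁ next-search (n ∷ state n ∷ [])

    state-comp : Comp₁ state
    state-comp = comp-ext (λ { (n ∷ []) → refl })
      (rec {h = λ n _ → state n} const-zero (proj₁ (proj₂ next-search)) (λ _ → refl) (λ { _ [] → refl }))

    state-next : ∀ n → Next n (state n) (state (suc n))
    state-next n = proj₂ (proj₂ next-search) (n ∷ state n ∷ [])

    state-good : ∀ n → PartialMatching _~_ (horizon n) (at (state n))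
    -- Since `horizon 0` is 0, the matching required at the start is empty, and any code will do.
    state-good zero rewrite horizon₀ = record { edge = λ _ () ; involutes = λ _ () ; injective = λ _ () }
    state-good (suc n) = proj₁ (state-next n (state-good n))

    -- Passing from state `n` to state `suc n` preserves the entries below `n`, so entry `i` is
    -- final from state `suc i` on.
    matching : ℕ → ℕ
    matching i = at (state (suc i)) i

    matching-comp : Comp₁ matching
    matching-comp = ap₂ at at-comp (ap₁ state state-comp (ap₁ suc suc-comp (var 0F))) (var 0F)

    state-stable : ∀ {i n} → i < n → at (state n) i ≡ matching i
    state-stable {i} {suc n} i<1+n with m≤n⇒m<n∨m≡n (≤-pred i<1+n)
    ... | inj₁ i<n  = trans (proj₂ (state-next n (state-good n)) i i<n) (state-stable i<n)
    ... | inj₂ refl = refl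

    matching-edge : ∀ i → i ~ matching i
    matching-edge i = PartialMatching.edge (state-good (suc i)) i (≤-trans (n<1+n i) (n≤horizon (suc i)))

    matching-involutive : ∀ i → matching (matching i) ≡ i
    matching-involutive i = begin
      matching (matching i)            ≡⟨ state-stable mi<k ⟨
      at (state k) (matching i)        ≡⟨ cong (at (state k)) (state-stable i<k) ⟨
      at (state k) (at (state k) i)    ≡⟨ PartialMatching.involutes (state-good k) i (≤-trans i<k (n≤horizon k))
                                            (≤-trans (subst (_< k) (sym (state-stable i<k)) mi<k) (n≤horizon k)) ⟩
      i                                ∎
      where
      open ≡-Reasoning
      -- A stage at which the entries of `i` and of its partner are both final.
      k = suc (i + matching i)
      i<k : i < k
      i<k = s≤s (m≤m+n i _)
      mi<k : matching i < k
      mi<k = s≤s (m≤n+m (matching i) i)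

-- Augmenting matchings

private variable
  a p : Level
  A : Set a

unique-⊆⇒length≤ : {xs ys : List A} → Unique xs → (∀ {x} → x ∈ˡ xs → x ∈ˡ ys) → length xs ≤ length ys
unique-⊆⇒length≤ {xs = []} _ _ = z≤n
unique-⊆⇒length≤ {xs = x ∷ xs} (x∉ ∷ u) ⊆ys with ∈-∃++ (⊆ys (here refl))
... | as , bs , refl rewrite length-++-sucʳ as x bs = s≤s (unique-⊆⇒length≤ u drop-x)
  where
  drop-x : ∀ {z} → z ∈ˡ xs → z ∈ˡ as ++ bs
  drop-x z∈ with ∈-++⁻ as (⊆ys (there z∈))
  ... | inj₁ z∈as          = ∈-++⁺ˡ z∈as
  ... | inj₂ (there z∈bs)  = ∈-++⁺ʳ as z∈bs
  ... | inj₂ (here refl)   = ⊥-elim (All.lookup x∉ z∈ refl)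

length-filter-split : {P : Pred A p} (P? : Decidable P) (xs : List A) →
                      length xs ≡ length (filter P? xs) + length (filter (¬? ∘ P?) xs)
length-filter-split P? [] = refl
length-filter-split P? (x ∷ xs) with P? x
... | yes _ = cong suc (length-filter-split P? xs)
... | no  _ = trans (cong suc (length-filter-split P? xs)) (sym (+-suc _ _))

map-unique : ∀ {B : Set} {f : A → B} {xs} → (∀ {x y} → x ∈ˡ xs → y ∈ˡ xs → f x ≡ f y → x ≡ y) →
             Unique xs → Unique (map f xs)
map-unique {xs = []} inj [] = []
map-unique {f = f} {xs = x ∷ xs} inj (x∉ ∷ u) =
  All.tabulate (λ z∈ eq → let (y , y∈ , z≡fy) = ∈-map⁻ f z∈ in
    All.lookup x∉ y∈ (inj (here refl) (there y∈) (trans eq z≡fy)))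
  ∷ map-unique (λ a b → inj (there a) (there b)) u

module Augmentation
  (em : {A : Set} → Dec A)
  (_~_ : ℕ → ℕ → Set) (~-sym : ∀ {u v} → u ~ v → v ~ u)
  (color : ℕ → Bool) (~-color : ∀ {u v} → u ~ v → color u ≢ color v)
  where

  Expands : Pred ℕ _ → List ℕ → Set
  Expands Z S = Σ[ T ∈ List ℕ ] Unique T × length S ≤ length T × All (_∉ Z) T ×
                (∀ {t} → t ∈ˡ T → ∃[ s ] s ∈ˡ S × s ~ t)

  -- Hall's condition for the graph with `Z` deleted, imposed on both colour classes because
  -- vertices of either colour have to be saturated.
  HallOutside : Pred ℕ _ → Set
  HallOutside Z = ∀ b S → Unique S → All (λ s → color s ≡ b) S → All (_∉ Z) S → Expands Z S

  -- A matching is an involution; its fixed points are the unmatched vertices.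
  record Matching (μ : ℕ → ℕ) : Set where
    field
      involutive : ∀ i → μ (μ i) ≡ i
      edge       : ∀ i → μ i ≢ i → i ~ μ i

    μ-injective : ∀ {i j} → μ i ≡ μ j → i ≡ j
    μ-injective {i} {j} eq = trans (sym (involutive i)) (trans (cong μ eq) (involutive j))

  open Matching

  ~⇒≢ : ∀ {u v} → u ~ v → u ≢ v
  ~⇒≢ u~v refl = ~-color u~v refl

  -- One step along an alternating path. The order of the tests matters when `u` is unmatched: then
  -- `μ u` is `u`, which gets matched with `s`, and no new hole arises.
  switch : (ℕ → ℕ) → ℕ → ℕ → ℕ → ℕ
  switch μ s u i with i ≟ s | i ≟ u | i ≟ μ u
  ... | yes _ | _     | _     = u
  ... | no  _ | yes _ | _     = s
  ... | no  _ | no  _ | yes _ = i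
  ... | no  _ | no  _ | no  _ = μ i

  module Switch {μ} (M : Matching μ) {s u} (μs≡s : μ s ≡ s) (s~u : s ~ u) where
    ν : ℕ → ℕ
    ν = switch μ s u

    at-s : ν s ≡ u
    at-s with s ≟ s
    ... | yes _  = refl
    ... | no s≢s = ⊥-elim (s≢s refl)

    at-u : ν u ≡ s
    at-u with u ≟ s | u ≟ u
    ... | yes refl | _      = refl
    ... | no _     | yes _  = refl
    ... | no _     | no u≢u = ⊥-elim (u≢u refl)

    at-partner : ∀ {i} → i ≢ s → i ≢ u → i ≡ μ u → ν i ≡ i
    at-partner {i} i≢s i≢u i≡μu with i ≟ s | i ≟ u | i ≟ μ u
    ... | yes eq | _     | _     = ⊥-elim (i≢s eq)
    ... | no  _ | yes eq | _     = ⊥-elim (i≢u eq)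
    ... | no  _ | no  _ | yes _ = refl
    ... | no  _ | no  _ | no ne = ⊥-elim (ne i≡μu)

    elsewhere : ∀ {i} → i ≢ s → i ≢ u → i ≢ μ u → ν i ≡ μ i
    elsewhere {i} i≢s i≢u i≢μu with i ≟ s | i ≟ u | i ≟ μ u
    ... | yes eq | _     | _     = ⊥-elim (i≢s eq)
    ... | no  _ | yes eq | _     = ⊥-elim (i≢u eq)
    ... | no  _ | no  _ | yes eq = ⊥-elim (i≢μu eq)
    ... | no  _ | no  _ | no _ = refl

    data View (i : ℕ) : Set where
      is-s       : i ≡ s → View i
      is-u       : i ≡ u → View i
      is-partner : i ≢ s → i ≢ u → i ≡ μ u → View i
      other      : i ≢ s → i ≢ u → i ≢ μ u → View i

    view : ∀ i → View i
    view i with i ≟ s | i ≟ u | i ≟ μ u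
    ... | yes e | _     | _     = is-s e
    ... | no  x | yes e | _     = is-u e
    ... | no  x | no  y | yes e = is-partner x y e
    ... | no  x | no  y | no  z = other x y z

    switched : Matching ν
    switched .involutive i with view i
    ... | is-s refl = trans (cong ν at-s) at-u
    ... | is-u refl = trans (cong ν at-u) at-s
    ... | is-partner x y e = trans (cong ν (at-partner x y e)) (at-partner x y e)
    ... | other x y z = trans (cong ν (elsewhere x y z)) (trans (elsewhere μi≢s μi≢u μi≢μu) (M .involutive i))
      where
      μi≢s : μ i ≢ s
      μi≢s eq = x (μ-injective M (trans eq (sym μs≡s)))
      μi≢u : μ i ≢ u
      μi≢u eq = z (trans (sym (M .involutive i)) (cong μ eq))
      μi≢μu : μ i ≢ μ u
      μi≢μu = y ∘ μ-injective M
    switched .edge i νi≢i with view i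
    ... | is-s refl = subst (i ~_) (sym at-s) s~u
    ... | is-u refl = subst (i ~_) (sym at-u) (~-sym s~u)
    ... | is-partner x y e = ⊥-elim (νi≢i (at-partner x y e))
    ... | other x y z = subst (i ~_) (sym (elsewhere x y z)) (M .edge i (νi≢i ∘ trans (elsewhere x y z)))

    -- The only possible new hole is `μ u`. The first hypothesis excludes it in both situations that
    -- occur: `i` differs from `μ u`, or `u` was free and `μ u` is `u` itself.
    switched-matched : ∀ {i} → (i ≡ μ u → i ≡ u) → (i ≢ s → μ i ≢ i) → ν i ≢ i
    switched-matched {i} partner⇒u matched with view i
    ... | is-s refl = λ νs≡s → ~⇒≢ s~u (trans (sym νs≡s) at-s)
    ... | is-u refl = λ νu≡u → ~⇒≢ s~u (trans (sym at-u) νu≡u)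
    ... | is-partner _ i≢u e = ⊥-elim (i≢u (partner⇒u e))
    ... | other x y z = matched x ∘ trans (sym (elsewhere x y z))

  -- The hole p is moved around, rematching s with a neighbour u and making the old partner
  -- of u the new hole.  If neither a free neighbour nor a hole above p ever turns up, then
  -- all holes are ≤ p, and the original matching μ₀ (not the current one) maps the neighbours
  -- outside Z of the set of holes injectively into that set minus p, against Hall's condition.
  module _ {Z : Pred ℕ _} (hall : HallOutside Z)
           {μ₀} (M₀ : Matching μ₀) (Z-closed : ∀ z → z ∈ Z → μ₀ z ∈ Z)
           {p} (v∉Z : p ∉ Z) (v-hole : μ₀ p ≡ p) (matched₀ : ∀ i → i < p → μ₀ i ≢ i)
           where

    data Reach : (ℕ → ℕ) → ℕ → Set where
      origin : Reach μ₀ p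
      move  : ∀ {μ s u} → Reach μ s → s ~ u → u ∉ Z → μ u ≢ u → Reach (switch μ s u) (μ u)

    Hole : ℕ → Set
    Hole s = ∃[ μ ] Reach μ s

    record Invariant (μ : ℕ → ℕ) (s : ℕ) : Set where
      field
        matching : Matching μ
        hole     : μ s ≡ s
        outside  : s ∉ Z
        fixed    : ∀ z → z ∈ Z → μ z ≡ μ₀ z
        colored  : color s ≡ color p
        -- The first move that touches u turns μ₀ u into the hole.
        moved    : ∀ u → color u ≢ color p → μ u ≡ μ₀ u ⊎ Hole (μ₀ u)
        matched  : ∀ i → i < suc p → i ≢ s → μ i ≢ i

    open Invariant

    other-color : ∀ {x y z : Bool} → x ≢ y → y ≢ z → x ≡ z
    other-color {false} {false} x≢y y≢z = ⊥-elim (x≢y refl)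
    other-color {false} {true} {false} x≢y y≢z = refl
    other-color {false} {true} {true} x≢y y≢z = ⊥-elim (y≢z refl)
    other-color {true} {true} x≢y y≢z = ⊥-elim (x≢y refl)
    other-color {true} {false} {true} x≢y y≢z = refl
    other-color {true} {false} {false} x≢y y≢z = ⊥-elim (y≢z refl)

    invariant : ∀ {μ s} → Reach μ s → Invariant μ s
    invariant origin = record
      { matching = M₀ ; hole = v-hole ; outside = v∉Z ; fixed = λ _ _ → refl ; colored = refl
      ; moved = λ _ _ → inj₁ refl
      ; matched = λ i i<1+p i≢p → matched₀ i (≤∧≢⇒< (≤-pred i<1+p) i≢p) }
    invariant (move {μ} {s} {u} r s~u u∉Z μu≢u) = record
      { matching = switched
      ; hole = at-partner μu≢s μu≢u refl
      ; outside = μu∉Z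
      ; fixed = λ z z∈Z → trans (elsewhere (λ { refl → I .outside z∈Z }) (λ { refl → u∉Z z∈Z }) (λ { refl → μu∉Z z∈Z }))
                                 (I .fixed z z∈Z)
      ; colored = sym (other-color p≢u (~-color (I .matching .edge u μu≢u)))
      ; moved = moved′
      ; matched = λ i i<1+p i≢μu → switched-matched (⊥-elim ∘ i≢μu) (I .matched i i<1+p)
      }
      where
      I = invariant r
      open Switch (I .matching) (I .hole) s~u
      μu≢s : μ u ≢ s
      μu≢s eq = ~⇒≢ s~u (sym (μ-injective (I .matching) (trans eq (sym (I .hole)))))
      μμu≡u = I .matching .involutive u
      μu∉Z : μ u ∉ Z
      -- On `Z` the matchings `μ` and `μ₀` agree and `μ₀` preserves `Z`, so `u`, being `μ (μ u)`,
      -- would lie in `Z` too.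
      μu∉Z μu∈Z = u∉Z (subst (_∈ Z) (trans (sym (I .fixed _ μu∈Z)) μμu≡u) (Z-closed _ μu∈Z))
      p≢u : color p ≢ color u
      p≢u eq = ~-color s~u (trans (I .colored) eq)
      moved′ : ∀ w → color w ≢ color p → switch μ s u w ≡ μ₀ w ⊎ Hole (μ₀ w)
      moved′ w w≢p with view w
      ... | is-s refl = ⊥-elim (w≢p (I .colored))
      ... | is-partner _ _ refl = ⊥-elim (w≢p (sym (other-color p≢u (~-color (I .matching .edge u μu≢u)))))
      ... | other x y z = subst (λ k → k ≡ μ₀ w ⊎ Hole (μ₀ w)) (sym (elsewhere x y z)) (I .moved w w≢p)
      ... | is-u refl with I .moved w w≢p
      ...   | inj₂ h  = inj₂ h
      ...   | inj₁ eq = inj₂ (switch μ s u , subst (Reach _) eq (move r s~u u∉Z μu≢u))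

    Augmented : Set
    Augmented = Σ[ ν ∈ (ℕ → ℕ) ] Matching ν × (∀ z → z ∈ Z → ν z ≡ μ₀ z) × (∀ i → i < suc p → ν i ≢ i)

    augment : Augmented
    augment with em {Augmented}
    ... | yes A = A
    ... | no ¬A = ⊥-elim (1+n≰n (begin
        suc (length S)             ≤⟨ s≤s S≤T ⟩
        suc (length T)             ≡⟨ cong suc (length-map μ₀ T) ⟨
        suc (length (map μ₀ T))    ≤⟨ unique-⊆⇒length≤ (p∉ ∷ Unique.map⁺ (μ-injective M₀) T-unique) ⊆S ⟩
        length S                   ∎))
      where
      open ≤-Reasoning
      Hole? : ∀ s → Dec (Hole s)
      Hole? _ = em
      S = filter Hole? (upTo (suc p))

      hole⇒∈S : ∀ {s} → Hole s → s ∈ˡ S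
      hole⇒∈S {s} (μ , r) = ∈-filter⁺ Hole? (∈-upTo⁺ (s≤s (≮⇒≥ not-above))) (μ , r)
        where
        I = invariant r
        not-above : ¬ (p < s)
        not-above p<s = ¬A (μ , I .matching , I .fixed , λ i i<1+p → I .matched i i<1+p (λ { refl → <⇒≱ i<1+p p<s }))

      no-free : ∀ {μ s u} → Reach μ s → s ~ u → u ∉ Z → μ u ≢ u
      no-free {μ} {s} {u} r s~u u∉Z μu≡u =
        ¬A (switch μ s u , switched ,
            (λ z z∈Z → trans (elsewhere (λ { refl → I .outside z∈Z }) (λ { refl → u∉Z z∈Z }) (λ z≡μu → u∉Z (subst (_∈ Z) (trans z≡μu μu≡u) z∈Z)))
                             (I .fixed z z∈Z)) ,
            λ i i<1+p → switched-matched (λ i≡μu → trans i≡μu μu≡u) (I .matched i i<1+p))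
        where
        I = invariant r
        open Switch (I .matching) (I .hole) s~u

      ∈S⇒hole : ∀ {s} → s ∈ˡ S → Hole s
      ∈S⇒hole s∈S = proj₂ (∈-filter⁻ Hole? {xs = upTo (suc p)} s∈S)

      expansion = hall (color p) S (Unique.filter⁺ Hole? (Unique.upTo⁺ (suc p)))
        (All.tabulate λ s∈S → invariant (proj₂ (∈S⇒hole s∈S)) .colored)
        (All.tabulate λ s∈S → invariant (proj₂ (∈S⇒hole s∈S)) .outside)
      T = proj₁ expansion
      T-unique = proj₁ (proj₂ expansion)
      S≤T = proj₁ (proj₂ (proj₂ expansion))
      T∉Z = proj₁ (proj₂ (proj₂ (proj₂ expansion)))
      T~S = proj₂ (proj₂ (proj₂ (proj₂ expansion)))

      color-T : ∀ {t} → t ∈ˡ T → color t ≢ color p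
      color-T t∈T eq = let (s , s∈S , s~t) = T~S t∈T ; (μ , r) = ∈S⇒hole s∈S in
        ~-color s~t (trans (invariant r .colored) (sym eq))

      T⇒hole : ∀ {t} → t ∈ˡ T → Hole (μ₀ t)
      T⇒hole {t} t∈T with T~S t∈T
      ... | s , s∈S , s~t with ∈S⇒hole s∈S
      ...   | μ , r with invariant r .moved t (color-T t∈T)
      ...     | inj₂ h  = h
      ...     | inj₁ eq = switch μ s t , subst (Reach _) eq (move r s~t t∉Z (no-free r s~t t∉Z))
        where t∉Z = All.lookup T∉Z t∈T

      p∉ : All (p ≢_) (map μ₀ T)
      -- As `p` is fixed by `μ₀`, an element of `T` sent to `p` would be `p`, but the elements of
      -- `T` have the other colour.
      p∉ = All.tabulate λ {w} w∈ p≡w → let (t , t∈T , w≡μt) = ∈-map⁻ μ₀ w∈ in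
        color-T t∈T (cong color (μ-injective M₀ (trans (sym w≡μt) (trans (sym p≡w) (sym v-hole)))))

      ⊆S : ∀ {w} → w ∈ˡ p ∷ map μ₀ T → w ∈ˡ S
      ⊆S (here refl) = hole⇒∈S (μ₀ , origin)
      ⊆S (there w∈) with ∈-map⁻ μ₀ w∈
      ... | t , t∈T , refl = hole⇒∈S (T⇒hole t∈T)

-- Extending a partial matching

≤-suc⇒monotone : {b : ℕ → ℕ} → (∀ i → b i ≤ b (suc i)) → ∀ {i j} → i ≤ j → b i ≤ b j
≤-suc⇒monotone step {i} {j} i≤j with m≤n⇒m<n∨m≡n i≤j
... | inj₂ refl = ≤-refl
≤-suc⇒monotone step {i} {suc j} _ | inj₁ (s≤s i≤j) = ≤-trans (≤-suc⇒monotone step i≤j) (step j)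

-- Pigeonhole, peeling off the top layer. If an element lies at or above `b k`, discarding all such
-- elements leaves fewer than `k` of them for the first `k` layers; otherwise layer `k` is empty.
empty-layer : (b : ℕ → ℕ) → (∀ i → b i ≤ b (suc i)) → ∀ k (S : List ℕ) → length S < k →
              Σ[ i ∈ ℕ ] i < k × (∀ {s} → s ∈ˡ S → b i ≤ s → b (suc i) ≤ s)
empty-layer b mono (suc k) S len with split
  where
  split : (∀ {s} → s ∈ˡ S → b k ≤ s → b (suc k) ≤ s) ⊎ (Σ[ s ∈ ℕ ] s ∈ˡ S × b k ≤ s)
  split with All.all? (_<? b k) S
  ... | yes all = inj₁ λ s∈ b≤s → ⊥-elim (<⇒≱ (All.lookup all s∈) b≤s)
  ... | no ¬all = inj₂ (proj₁ w , proj₁ (proj₂ w) , ≮⇒≥ (proj₂ (proj₂ w)))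
    where
    w = find (All.¬All⇒Any¬ (_<? b k) S ¬all)
... | inj₁ empty = k , n<1+n k , empty
... | inj₂ (s , s∈S , bk≤s) = i , m<n⇒m<1+n i<k , clear
  where
  S′ = filter (_<? b k) S
  below = empty-layer b mono k S′ (<-≤-trans (filter-notAll (_<? b k) S (lose s∈S (≤⇒≯ bk≤s))) (≤-pred len))
  i = proj₁ below
  i<k = proj₁ (proj₂ below)
  clear : ∀ {s} → s ∈ˡ S → b i ≤ s → b (suc i) ≤ s
  clear {s} s∈ bi≤s with s <? b k
  ... | yes s<bk = proj₂ (proj₂ below) (∈-filter⁺ (_<? b k) s∈ s<bk) bi≤s
  ... | no  s≮bk = ≤-trans (≤-suc⇒monotone mono i<k) (≮⇒≥ s≮bk)

module Extension
  (em : {A : Set} → Dec A)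
  (_~_ : ℕ → ℕ → Set) (~-sym : ∀ {u v} → u ~ v → v ~ u)
  (color : ℕ → Bool) (~-color : ∀ {u v} → u ~ v → color u ≢ color v)
  (g : ℕ → ℕ) (k≤g : ∀ k → k ≤ g k) (~-bound : ∀ {u v k} → u ~ v → u < k → v < g k)
  (expand : ∀ b S → Unique S → All (λ s → color s ≡ b) S →
            Σ[ T ∈ List ℕ ] Unique T × 2 * length S ≤ length T ×
            (∀ {t} → t ∈ˡ T → ∃[ s ] s ∈ˡ S × s ~ t))
  where
  open Augmentation em _~_ ~-sym color ~-color
  open Matching

  -- Augments at each hole in increasing order. Every augmentation leaves the matching on `Z` as it
  -- was, so the same `Z`, with the same Hall condition, serves throughout.
  saturate : {Z : Pred ℕ _} → HallOutside Z → ∀ {μ₀} → Matching μ₀ →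
             (∀ z → z ∈ Z → μ₀ z ∈ Z) → (∀ z → z ∈ Z → μ₀ z ≢ z) →
             ∀ p → Σ[ ν ∈ (ℕ → ℕ) ] Matching ν × (∀ z → z ∈ Z → ν z ≡ μ₀ z) × (∀ i → i < p → ν i ≢ i)
  saturate hall {μ₀} M₀ closed matched zero = μ₀ , M₀ , (λ _ _ → refl) , λ _ ()
  saturate {Z} hall {μ₀} M₀ closed matched (suc p) with saturate hall M₀ closed matched p
  ... | μ , M , μ≗ , μ-matched with μ p ≟ p
  ...   | no μp≢p = μ , M , μ≗ , λ i i<1+p → [ μ-matched i , (λ { refl → μp≢p }) ]′ (m≤n⇒m<n∨m≡n (≤-pred i<1+p))
  ...   | yes μp≡p =
    let ν , N , ν≗ , ν-matched = augment hall M (λ z z∈Z → subst (_∈ Z) (sym (μ≗ z z∈Z)) (closed z z∈Z))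
                                   (λ p∈Z → matched p p∈Z (trans (sym (μ≗ p p∈Z)) μp≡p)) μp≡p μ-matched
    in ν , N , (λ z z∈Z → trans (ν≗ z z∈Z) (μ≗ z z∈Z)) , ν-matched

  -- The first bound is `g n` because the vertices below `n` and their partners lie under it. Each
  -- layer has a width of two applications of `g`, so that neighbours of vertices inside an empty
  -- layer and of vertices beyond it cannot coincide.
  layer : ℕ → ℕ → ℕ
  layer n zero    = g n
  layer n (suc i) = g (g (layer n i))

  layer-mono : ∀ n i → layer n i ≤ layer n (suc i)
  layer-mono n i = ≤-trans (k≤g _) (k≤g _)

  layer-≤ : ∀ n {i j} → i ≤ j → layer n i ≤ layer n j
  layer-≤ n = ≤-suc⇒monotone (layer-mono n)

  horizon : ℕ → ℕ
  horizon n = layer n (2 * n)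

  n≤horizon : ∀ n → n ≤ horizon n
  n≤horizon n = ≤-trans (k≤g n) (layer-≤ n {0} {2 * n} z≤n)

  module _ (n : ℕ) (c : ℕ → ℕ) (good : PartialMatching _~_ (horizon n) c) where
    open PartialMatching good renaming (edge to c-edge; involutes to c-involutes; injective to c-injective)

    <h : ∀ {i} → i < n → i < horizon n
    <h i<n = ≤-trans i<n (n≤horizon n)

    Partner : ℕ → Set
    Partner v = Σ[ i ∈ ℕ ] i < n × c i ≡ v

    Z : Pred ℕ _
    Z v = v < n ⊎ Partner v

    -- Keeps only the edges of `c` that start below `n`; the other values of `c` enter through
    -- Hall's condition alone.
    μ₀ : ℕ → ℕ
    μ₀ v with v <? n | em {Partner v}
    ... | yes _ | _           = c v
    ... | no  _ | yes (i , _) = i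
    ... | no  _ | no  _       = v

    μ₀-< : ∀ {v} → v < n → μ₀ v ≡ c v
    μ₀-< {v} v<n with v <? n | em {Partner v}
    ... | yes _   | _ = refl
    ... | no  v≮n | _ = ⊥-elim (v≮n v<n)

    μ₀-partner : ∀ {i} → i < n → μ₀ (c i) ≡ i
    μ₀-partner {i} i<n with c i <? n | em {Partner (c i)}
    ... | yes ci<n | _ = c-involutes i (<h i<n) (<h ci<n)
    ... | no  _    | yes (j , j<n , cj≡ci) = c-injective j (<h j<n) i (<h i<n) cj≡ci
    ... | no  _    | no ¬partner = ⊥-elim (¬partner (i , i<n , refl))

    μ₀-outside : ∀ {v} → v ∉ Z → μ₀ v ≡ v
    μ₀-outside {v} v∉Z with v <? n | em {Partner v}
    ... | yes v<n | _     = ⊥-elim (v∉Z (inj₁ v<n))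
    ... | no  _   | yes p = ⊥-elim (v∉Z (inj₂ p))
    ... | no  _   | no  _ = refl

    Z-edge : ∀ z → z ∈ Z → z ~ μ₀ z
    Z-edge z (inj₁ z<n) = subst (z ~_) (sym (μ₀-< z<n)) (c-edge z (<h z<n))
    Z-edge z (inj₂ (i , i<n , refl)) = subst (z ~_) (sym (μ₀-partner i<n)) (~-sym (c-edge i (<h i<n)))

    Z-closed : ∀ z → z ∈ Z → μ₀ z ∈ Z
    Z-closed z (inj₁ z<n) = inj₂ (z , z<n , sym (μ₀-< z<n))
    Z-closed z (inj₂ (i , i<n , refl)) = inj₁ (subst (_< n) (sym (μ₀-partner i<n)) i<n)

    M₀ : Matching μ₀
    M₀ .involutive v with em {Z v}
    ... | no v∉Z = trans (cong μ₀ (μ₀-outside v∉Z)) (μ₀-outside v∉Z)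
    ... | yes (inj₁ v<n) = trans (cong μ₀ (μ₀-< v<n)) (μ₀-partner v<n)
    ... | yes (inj₂ (i , i<n , refl)) = trans (cong μ₀ (μ₀-partner i<n)) (μ₀-< i<n)
    M₀ .edge v μv≢v with em {Z v}
    ... | no v∉Z  = ⊥-elim (μv≢v (μ₀-outside v∉Z))
    ... | yes v∈Z = Z-edge v v∈Z

    Zlist : List ℕ
    Zlist = upTo n ++ map c (upTo n)

    length-Zlist : length Zlist ≡ 2 * n
    length-Zlist = begin
      length Zlist                                    ≡⟨ length-++ (upTo n) ⟩
      length (upTo n) + length (map c (upTo n))       ≡⟨ cong (length (upTo n) +_) (length-map c (upTo n)) ⟩
      length (upTo n) + length (upTo n)               ≡⟨ cong₂ _+_ (length-upTo n) (trans (length-upTo n) (sym (+-identityʳ n))) ⟩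
      2 * n                                           ∎
      where open ≡-Reasoning

    Z⊆Zlist : ∀ {v} → v ∈ Z → v ∈ˡ Zlist
    Z⊆Zlist (inj₁ v<n) = ∈-++⁺ˡ (∈-upTo⁺ v<n)
    Z⊆Zlist (inj₂ (i , i<n , refl)) = ∈-++⁺ʳ (upTo n) (∈-map⁺ c (∈-upTo⁺ i<n))

    Z-< : ∀ {v} → v ∈ Z → v < g n
    Z-< (inj₁ v<n) = ≤-trans v<n (k≤g n)
    Z-< (inj₂ (i , i<n , refl)) = ~-bound (c-edge i (<h i<n)) i<n

    -- `Z` consists of whole matched pairs of `c`, so a partner in `Z` would put `v` in `Z`: as
    -- `c (c v)` if `c v` is below `n`, and by injectivity if `c v` is the partner of a vertex below
    -- `n`.
    c∉Z : ∀ {v} → v < horizon n → v ∉ Z → c v ∉ Z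
    c∉Z {v} v<h v∉Z (inj₁ cv<n) = v∉Z (inj₂ (c v , cv<n , c-involutes v v<h (<h cv<n)))
    c∉Z {v} v<h v∉Z (inj₂ (i , i<n , ci≡cv)) = v∉Z (inj₁ (subst (_< n) (c-injective i (<h i<n) v v<h ci≡cv) i<n))

    Z? : Decidable Z
    Z? _ = em

    hall : HallOutside Z
    hall b S S-unique S-mono S∉Z with 2 * n ≤? length S
    -- Expansion gives twice as many neighbours as `S` has elements, and deleting `Z` costs at most
    -- `2 * n` of them, hence at most `length S`.
    ... | yes 2n≤S = T , Unique.filter⁺ _ T₀-unique , S≤T ,
                     All.tabulate (λ t∈ → proj₂ (∈-filter⁻ (¬? ∘ Z?) {xs = T₀} t∈)) ,
                     λ t∈ → T₀~S (proj₁ (∈-filter⁻ (¬? ∘ Z?) {xs = T₀} t∈))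
      where
      expansion = expand b S S-unique S-mono
      T₀ = proj₁ expansion
      T₀-unique = proj₁ (proj₂ expansion)
      T₀~S = proj₂ (proj₂ (proj₂ expansion))
      T = filter (¬? ∘ Z?) T₀
      S≤T : length S ≤ length T
      S≤T = +-cancelˡ-≤ (length S) _ _ (begin
        length S + length S                   ≡⟨ cong (length S +_) (+-identityʳ (length S)) ⟨
        2 * length S                          ≤⟨ proj₁ (proj₂ (proj₂ expansion)) ⟩
        length T₀                             ≡⟨ length-filter-split Z? T₀ ⟩
        length (filter Z? T₀) + length T      ≤⟨ +-monoˡ-≤ (length T) (unique-⊆⇒length≤ (Unique.filter⁺ Z? T₀-unique)
                                                   (λ t∈ → Z⊆Zlist (proj₂ (∈-filter⁻ Z? {xs = T₀} t∈)))) ⟩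
        length Zlist + length T               ≡⟨ cong (_+ length T) length-Zlist ⟩
        2 * n + length T                      ≤⟨ +-monoˡ-≤ (length T) 2n≤S ⟩
        length S + length T                   ∎)
        where open ≤-Reasoning
    ... | no 2n≰S = T , T-unique , S≤T , All.tabulate T∉Z , T~S
      where
      -- No element of `S` lies between `β` and `g (g β)`. The part `S₁` below gets its partners
      -- under `c`, all below `g β`; the part `S₂` above gets neighbours by expansion, all at or
      -- above `g β`. The latter miss `Z`, which lies below `g n`.
      empty = empty-layer (layer n) (layer-mono n) (2 * n) S (≰⇒> 2n≰S)
      i = proj₁ empty
      β = layer n i
      inner? = _<? β
      S₁ = filter inner? S
      S₂ = filter (¬? ∘ inner?) S
      S₁-< : ∀ {s} → s ∈ˡ S₁ → s < β
      S₁-< s∈ = proj₂ (∈-filter⁻ inner? {xs = S} s∈)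
      S₁⊆ : ∀ {s} → s ∈ˡ S₁ → s ∈ˡ S
      S₁⊆ s∈ = proj₁ (∈-filter⁻ inner? {xs = S} s∈)
      S₂⊆ : ∀ {s} → s ∈ˡ S₂ → s ∈ˡ S
      S₂⊆ s∈ = proj₁ (∈-filter⁻ (¬? ∘ inner?) {xs = S} s∈)
      S₂-≥ : ∀ {s} → s ∈ˡ S₂ → g (g β) ≤ s
      S₂-≥ s∈ = proj₂ (proj₂ empty) (S₂⊆ s∈) (≮⇒≥ (proj₂ (∈-filter⁻ (¬? ∘ inner?) {xs = S} s∈)))
      β≤h : β ≤ horizon n
      β≤h = layer-≤ n (<⇒≤ (proj₁ (proj₂ empty)))
      S₁-<h : ∀ {s} → s ∈ˡ S₁ → s < horizon n
      S₁-<h s∈ = ≤-trans (S₁-< s∈) β≤h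
      expansion = expand b S₂ (Unique.filter⁺ (¬? ∘ inner?) S-unique)
                    (All.tabulate λ s∈ → All.lookup S-mono (S₂⊆ s∈))
      T₂ = proj₁ expansion
      T₂~S₂ = proj₂ (proj₂ (proj₂ expansion))
      T₁ = map c S₁
      T = T₁ ++ T₂
      T₁-< : ∀ {t} → t ∈ˡ T₁ → t < g β
      T₁-< t∈ with ∈-map⁻ c t∈
      ... | s , s∈ , refl = ~-bound (c-edge s (S₁-<h s∈)) (S₁-< s∈)
      T₂-≥ : ∀ {t} → t ∈ˡ T₂ → g β ≤ t
      T₂-≥ t∈ = let (s , s∈ , s~t) = T₂~S₂ t∈ in
        ≮⇒≥ λ t< → <⇒≱ (~-bound (~-sym s~t) t<) (S₂-≥ s∈)
      T-unique = Unique.++⁺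
        (map-unique (λ x∈ y∈ → c-injective _ (S₁-<h x∈) _ (S₁-<h y∈)) (Unique.filter⁺ inner? S-unique))
        (proj₁ (proj₂ expansion))
        (λ (t∈₁ , t∈₂) → <⇒≱ (T₁-< t∈₁) (T₂-≥ t∈₂))
      S≤T : length S ≤ length T
      S≤T = begin
        length S                          ≡⟨ length-filter-split inner? S ⟩
        length S₁ + length S₂             ≤⟨ +-monoʳ-≤ (length S₁) (m≤m+n (length S₂) _) ⟩
        length S₁ + 2 * length S₂         ≤⟨ +-mono-≤ (≤-reflexive (sym (length-map c S₁))) (proj₁ (proj₂ (proj₂ expansion))) ⟩
        length T₁ + length T₂             ≡⟨ length-++ T₁ ⟨
        length T                          ∎
        where open ≤-Reasoning
      T∉Z : ∀ {t} → t ∈ˡ T → t ∉ Z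
      T∉Z t∈ t∈Z with ∈-++⁻ T₁ t∈
      ... | inj₂ t∈₂ = <⇒≱ (Z-< t∈Z) (≤-trans (layer-≤ n {0} {i} z≤n) (≤-trans (k≤g β) (T₂-≥ t∈₂)))
      ... | inj₁ t∈₁ with ∈-map⁻ c t∈₁
      ...   | s , s∈ , refl = c∉Z (S₁-<h s∈) (All.lookup S∉Z (S₁⊆ s∈)) t∈Z
      T~S : ∀ {t} → t ∈ˡ T → ∃[ s ] s ∈ˡ S × s ~ t
      T~S t∈ with ∈-++⁻ T₁ t∈
      ... | inj₂ t∈₂ = let (s , s∈ , s~t) = T₂~S₂ t∈₂ in s , S₂⊆ s∈ , s~t
      ... | inj₁ t∈₁ with ∈-map⁻ c t∈₁
      ...   | s , s∈ , refl = s , S₁⊆ s∈ , c-edge s (S₁-<h s∈)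

    extend : ∀ p → ∃[ d ] PartialMatching _~_ p d × (∀ i → i < n → d i ≡ c i)
    extend p =
      let ν , N , ν≗ , ν-matched = saturate hall M₀ Z-closed (λ z z∈Z μz≡z → ~⇒≢ (Z-edge z z∈Z) (sym μz≡z)) p in
      ν ,
      record { edge = λ i i<p → N .edge i (ν-matched i i<p)
             ; involutes = λ i _ _ → N .involutive i
             ; injective = λ i _ j _ → μ-injective N } ,
      λ i i<n → trans (ν≗ i (inj₁ i<n)) (μ₀-< i<n)

-- Pseudogroups and expansion

Maps : Transformation → ℕ → ℕ → Set
Maps ρ x y = Σ[ p ∈ x ∈ α ρ ] apply ρ x p ≡ y

apply-irrelevant : ∀ ρ {x x′} (p : x ∈ α ρ) (q : x′ ∈ α ρ) → x ≡ x′ → apply ρ x p ≡ apply ρ x′ q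
apply-irrelevant ρ p q x≡x′ = Bijection.cong (bij ρ) {_ , p} {_ , q} x≡x′

Maps-⁻¹ : ∀ ρ {x y} → Maps ρ x y → Maps (ρ ⁻¹) y x
Maps-⁻¹ ρ (p , refl) =
  proj₂ (Bijection.to (bij ρ) (_ , p)) , Inverse.strictlyInverseʳ (Bijection⇒Inverse (bij ρ)) (_ , p)

Maps-⁻¹-reflects : ∀ ρ {x y} → Maps (ρ ⁻¹) y x → Maps ρ x y
Maps-⁻¹-reflects ρ (q , refl) =
  proj₂ (Inverse.from (Bijection⇒Inverse (bij ρ)) (_ , q)) ,
  Inverse.strictlyInverseˡ (Bijection⇒Inverse (bij ρ)) (_ , q)

-- The domain is tested before e is run, since e may diverge off the domain.
extend-by-zero : ∀ ρ → ComputableTransformation ρ →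
                 Σ[ f ∈ (ℕ → ℕ) ] Comp₁ f × (∀ x p → f x ≡ apply ρ x p)
extend-by-zero ρ ((d , dom) , _ , (e , run)) = f , (code , λ { (x ∷ []) → runs x }) , agrees
  where
  f : ℕ → ℕ
  f x with dom x
  ... | inj₁ (p , _) = apply ρ x p
  ... | inj₂ _       = 0
  agrees : ∀ x p → f x ≡ apply ρ x p
  agrees x p with dom x
  ... | inj₁ (q , _)   = apply-irrelevant ρ q p refl
  ... | inj₂ (x∉α , _) = ⊥-elim (x∉α p)
  code : Code 1
  -- Primitive recursion as a conditional on the value of `d`: at 0 the result is 0, and at 1 the
  -- step runs `e` on `x`, which sits at index 2 behind the counter and the previous value.
  code = comp (prec (proj₁ (const-zero {1})) (comp e (proj 2F ∷ []))) (d ∷ proj 0F ∷ [])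
  runs : ∀ x → code [ x ∷ [] ]↓ f x
  runs x with dom x
  ... | inj₁ (p , r) = ↓comp (r ∷ ↓proj ∷ [])
          (↓precₛ (↓prec₀ (proj₂ (const-zero {1}) (x ∷ []))) (↓comp (↓proj ∷ []) (run x p)))
  ... | inj₂ (_ , r) = ↓comp (r ∷ ↓proj ∷ []) (↓prec₀ (proj₂ (const-zero {1}) (x ∷ [])))

Maps-decC : ∀ ρ → ComputableTransformation ρ → DecC₂ (Maps ρ)
Maps-decC ρ c = decC-ext
  (λ v (p , eq) → p , trans (sym (agrees _ p)) eq)
  (λ v (p , eq) → p , trans (agrees _ p) eq)
  (decC-ap₁ (α ρ) (ComputableSet⇒decC (proj₁ c)) (var 0F) ×ᶜ (ap₁ f f-comp (var 0F) ≡ᶜ var 1F))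
  where
  f = proj₁ (extend-by-zero ρ c)
  f-comp = proj₁ (proj₂ (extend-by-zero ρ c))
  agrees = proj₂ (proj₂ (extend-by-zero ρ c))

module Pseudogroup {ℓ} (𝒢 : Pred Transformation ℓ) (pg : IsPseudogroupOfComputableTransformations 𝒢) where
  open IsPseudogroupOfComputableTransformations pg
  open IsPseudogroup isPseudogroup

  Element : Set (lsuc 0ℓ ⊔ ℓ)
  Element = Σ Transformation 𝒢

  -- Recursion on the list keeps the relation in `Set`, as `DecC` requires; an existential over
  -- `Element` would live in a larger universe.
  Rel : List Element → ℕ → ℕ → Set
  Rel []            x y = ⊥
  Rel ((ρ , _) ∷ L) x y = Maps ρ x y ⊎ Rel L x y

  Rel⁺ : ∀ {ρ L x y} → ρ ∈ˡ L → Maps (proj₁ ρ) x y → Rel L x y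
  Rel⁺ (here refl) m = inj₁ m
  Rel⁺ (there ρ∈L) m = inj₂ (Rel⁺ ρ∈L m)

  Rel⁻ : ∀ L {x y} → Rel L x y → ∃[ ρ ] ρ ∈ˡ L × Maps (proj₁ ρ) x y
  Rel⁻ (ρ ∷ L) (inj₁ m) = ρ , here refl , m
  Rel⁻ (ρ ∷ L) (inj₂ r) = let (σ , σ∈L , m) = Rel⁻ L r in σ , there σ∈L , m

  Rel-++ˡ : ∀ L {L′ x y} → Rel L x y → Rel (L ++ L′) x y
  Rel-++ˡ L r = let (ρ , ρ∈ , m) = Rel⁻ L r in Rel⁺ (∈-++⁺ˡ ρ∈) m

  Rel-++ʳ : ∀ L {L′ x y} → Rel L′ x y → Rel (L ++ L′) x y
  Rel-++ʳ L {L′} r = let (ρ , ρ∈ , m) = Rel⁻ L′ r in Rel⁺ (∈-++⁺ʳ L ρ∈) m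

  abstract
    Rel-decC : ∀ L → DecC₂ (Rel L)
    Rel-decC []            = decC-ext (λ _ ()) (λ _ ()) (const-comp 1 ≡ᶜ const-comp 0)
    Rel-decC ((ρ , ρ∈𝒢) ∷ L) = Maps-decC ρ (computable ρ∈𝒢) ⊎ᶜ Rel-decC L

  inverse : Element → Element
  inverse (ρ , ρ∈𝒢) = ρ ⁻¹ , inverse∈ ρ∈𝒢

  symmetrize : List Element → List Element
  symmetrize L = L ++ map inverse L

  symmetrize-sym : ∀ L {x y} → Rel (symmetrize L) x y → Rel (symmetrize L) y x
  symmetrize-sym L r with Rel⁻ (symmetrize L) r
  ... | ρ , ρ∈ , m with ∈-++⁻ L ρ∈
  ...   | inj₁ ρ∈L = Rel⁺ (∈-++⁺ʳ L (∈-map⁺ inverse ρ∈L)) (Maps-⁻¹ (proj₁ ρ) m)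
  ...   | inj₂ ρ∈L⁻¹ with ∈-map⁻ inverse ρ∈L⁻¹
  ...     | σ , σ∈L , refl = Rel⁺ (∈-++⁺ˡ σ∈L) (Maps-⁻¹-reflects (proj₁ σ) m)

  restriction-≈ : ∀ ρ σ {S} (S⊆ρ : ∀ {x} → x ∈ S → x ∈ α ρ) (S⊆σ : ∀ {x} → x ∈ S → x ∈ α σ) →
                  (∀ x p → apply ρ x (S⊆ρ {x} p) ≡ apply σ x (S⊆σ p)) → restrict ρ S S⊆ρ ≈ restrict σ S S⊆σ
  restriction-≈ ρ σ S⊆ρ S⊆σ agree = record
    { α-≐ = id , id
    ; ω-≐ = (λ (x , p , eq) → x , p , trans (sym (agree x p)) eq) , λ (x , p , eq) → x , p , trans (agree x p) eq
    ; agree = λ x p q → trans (agree x p) (apply-irrelevant σ (S⊆σ p) (S⊆σ q) refl)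
    }

  -- `composition∈` wants the range of the first factor to be the domain of the second. So `ρ` is
  -- restricted to the points that it sends into the domain of `σ`, and `σ` to the resulting range.
  compose : Element → Element → Element
  compose (ρ , ρ∈𝒢) (σ , σ∈𝒢) = mk (bij ρ′ then bij σ′) , composition∈ (bij ρ′) (bij σ′) ρ′∈𝒢 σ′∈𝒢
    module Compose where
    S : Pred ℕ 0ℓ
    S x = Σ[ p ∈ x ∈ α ρ ] apply ρ x p ∈ α σ
    f,f-comp,agrees = extend-by-zero ρ (computable ρ∈𝒢)
    f = proj₁ f,f-comp,agrees
    agrees = proj₂ (proj₂ f,f-comp,agrees)
    S-computable : ComputableSet S
    S-computable = decC⇒ComputableSet (decC-ext
      (λ v (p , q) → p , subst (_∈ α σ) (agrees _ p) q)
      (λ v (p , q) → p , subst (_∈ α σ) (sym (agrees _ p)) q)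
      (ComputableSet⇒decC (proj₁ (computable ρ∈𝒢)) ×ᶜ
       decC-ap₁ (α σ) (ComputableSet⇒decC (proj₁ (computable σ∈𝒢))) (ap₁ f (proj₁ (proj₂ f,f-comp,agrees)) (var 0F))))
    ρ′ = restrict ρ S proj₁
    ρ′∈𝒢 = restriction∈ ρ∈𝒢 S-computable proj₁
    ω⊆α : ∀ {y} → y ∈ ω ρ′ → y ∈ α σ
    ω⊆α (_ , (_ , q) , refl) = q
    σ′ = restrict σ (ω ρ′) ω⊆α
    -- The range of `ρ′` is a computable set because `ρ′` is itself in `𝒢`.
    σ′∈𝒢 = restriction∈ σ∈𝒢 (proj₁ (proj₂ (computable ρ′∈𝒢))) ω⊆α

  Maps-compose : ∀ ρ σ {x y z} → Maps (proj₁ ρ) x y → Maps (proj₁ σ) y z → Maps (proj₁ (compose ρ σ)) x z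
  Maps-compose ρ σ (p , refl) (q , refl) = (p , q) , apply-irrelevant (proj₁ σ) _ q refl

  Rel-compose : ∀ L L′ {x y z} → Rel L x y → Rel L′ y z → Rel (cartesianProductWith compose L L′) x z
  Rel-compose L L′ r r′ =
    let (ρ , ρ∈ , m) = Rel⁻ L r ; (σ , σ∈ , m′) = Rel⁻ L′ r′ in
    Rel⁺ (∈-cartesianProductWith⁺ compose ρ∈ σ∈) (Maps-compose ρ σ m m′)

  -- Peels off the points at which the first element of `L` gives the value `f x`; this set and its
  -- complement are computable, so `gluing∈` applies to the two pieces.
  piecewise∈ : ∀ L (γ : Transformation) → ComputableSet (α γ) →
               ∀ f → Comp₁ f → (∀ x p → apply γ x p ≡ f x) → (∀ x → x ∈ α γ → Rel L x (f x)) → γ ∈ 𝒢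
  -- With nothing left to choose from, the domain is empty and is glued from no pieces.
  piecewise∈ [] γ S-computable f f-comp γ≗f rel = gluing∈ γ {0} {λ ()}
    (record { part⊆ = λ () ; covers = λ x∈ → ⊥-elim (rel _ x∈) ; disjoint = λ { {i = ()} } }) λ ()
  piecewise∈ ((ρ , ρ∈𝒢) ∷ L) γ S-computable f f-comp γ≗f rel =
    gluing∈ γ {2} {piece} partition λ { 0F → on-ρ ; 1F → rest }
    where
    maps? : DecC₁ λ x → Maps ρ x (f x)
    maps? = decC-ap₂ (Maps ρ) (Maps-decC ρ (computable ρ∈𝒢)) (var 0F) (ap₁ f f-comp (var 0F))
    piece : Fin 2 → Pred ℕ 0ℓ
    piece 0F x = x ∈ α γ × Maps ρ x (f x)
    piece 1F x = x ∈ α γ × ¬ Maps ρ x (f x)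
    piece-computable : ∀ j → ComputableSet (piece j)
    piece-computable 0F = decC⇒ComputableSet (ComputableSet⇒decC S-computable ×ᶜ maps?)
    piece-computable 1F = decC⇒ComputableSet (ComputableSet⇒decC S-computable ×ᶜ ¬ᶜ maps?)
    partition : IsPartition (α γ) piece
    partition = record { part⊆ = λ { 0F → proj₁ ; 1F → proj₁ } ; covers = cover ; disjoint = disj }
      where
      cover : ∀ {x} → x ∈ α γ → ∃[ j ] x ∈ piece j
      cover {x} x∈ with decC⇒Dec maps? (x ∷ [])
      ... | yes m = 0F , x∈ , m
      ... | no ¬m = 1F , x∈ , ¬m
      disj : ∀ {x i j} → x ∈ piece i → x ∈ piece j → i ≡ j
      disj {i = 0F} {0F} _ _ = refl
      disj {i = 0F} {1F} (_ , m) (_ , ¬m) = ⊥-elim (¬m m)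
      disj {i = 1F} {0F} (_ , ¬m) (_ , m) = ⊥-elim (¬m m)
      disj {i = 1F} {1F} _ _ = refl
    on-ρ : restrict γ (piece 0F) proj₁ ∈ 𝒢
    on-ρ = respects-≈
      (restriction-≈ ρ γ (λ (_ , p , _) → p) proj₁ λ x (x∈ , _ , eq) → trans eq (sym (γ≗f x x∈)))
      (restriction∈ ρ∈𝒢 (piece-computable 0F) λ (_ , p , _) → p)
    rest : restrict γ (piece 1F) proj₁ ∈ 𝒢
    rest = piecewise∈ L (restrict γ (piece 1F) proj₁) (piece-computable 1F) f f-comp
      (λ x (x∈ , _) → γ≗f x x∈) λ x (x∈ , ¬m) → [ ⊥-elim ∘ ¬m , id ]′ (rel x x∈)

-- From the failure of Følner's condition to expansion

unique-lookup-injective : ∀ {a} {A : Set a} {xs : List A} → Unique xs → ∀ {i j} →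
                          List.lookup xs i ≡ List.lookup xs j → i ≡ j
unique-lookup-injective (x∉ ∷ u) {zero}  {zero}  _  = refl
unique-lookup-injective (x∉ ∷ u) {zero}  {suc j} eq = ⊥-elim (All.lookup x∉ (∈-lookup j) eq)
unique-lookup-injective (x∉ ∷ u) {suc i} {zero}  eq = ⊥-elim (All.lookup x∉ (∈-lookup i) (sym eq))
unique-lookup-injective (x∉ ∷ u) {suc i} {suc j} eq = cong suc (unique-lookup-injective u eq)

enumeration⇒∣∣≡ : ∀ {a} {A : Pred ℕ a} {xs} → Unique xs →
                  (∀ {x} → x ∈ˡ xs → x ∈ A) → (∀ {x} → x ∈ A → x ∈ˡ xs) → ∣ A ∣≡ length xs
enumeration⇒∣∣≡ {xs = xs} u sound complete = record
  { to = λ i → List.lookup xs i , sound (∈-lookup i)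
  ; cong = cong (List.lookup xs)
  ; bijective = unique-lookup-injective u ,
      λ (x , x∈A) → Any.index (complete x∈A) , λ { refl → sym (lookup-index (complete x∈A)) }
  }

upper-bound : (xs : List ℕ) → ∃[ k ] ∀ {x} → x ∈ˡ xs → x < k
upper-bound [] = 0 , λ ()
upper-bound (x ∷ xs) = let (k , <k) = upper-bound xs in
  suc x + k , λ { (here refl) → m≤m+n (suc x) k ; (there x∈) → m≤n⇒m≤o+n (suc x) (<k x∈) }

module Growth {ℓ} (lem : ExcludedMiddle (lsuc 0ℓ ⊔ ℓ))
              (𝒢 : Pred Transformation ℓ) (pg : IsPseudogroupOfComputableTransformations 𝒢) where
  open IsPseudogroupOfComputableTransformations pg
  open IsPseudogroup isPseudogroup
  open Pseudogroup 𝒢 pg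

  em : {A : Set} → Dec A
  em {A} with lem {Lift (lsuc 0ℓ ⊔ ℓ) A}
  ... | yes a = yes (lower a)
  ... | no ¬a = no (¬a ∘ lift)

  em₁ : {A : Set₁} → Dec A
  em₁ {A} with lem {Lift (lsuc 0ℓ ⊔ ℓ) A}
  ... | yes a = yes (lower a)
  ... | no ¬a = no (¬a ∘ lift)

  -- Each element of `L` is a single computable function, so the images of an initial segment have a
  -- computable bound. The value at 0 is recorded because it makes the initial horizon 0.
  Rel-bound : ∀ L → Σ[ g ∈ (ℕ → ℕ) ] Comp₁ g × g 0 ≡ 0 × (∀ {x y k} → Rel L x y → x < k → y < g k)
  Rel-bound [] = (λ _ → 0) , const-zero , refl , λ ()
  Rel-bound ((ρ , ρ∈𝒢) ∷ L) =
    (λ k → sum< (suc ∘ f) k + g k) ,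
    ap₂ _+_ +-comp (instantiate (sum<-comp {n = 1} (ap₁ (suc ∘ f) (ap₁ suc suc-comp (ap₁ f f-comp (var 0F))) (var 0F))) (var 0F))
                   (ap₁ g g-comp (var 0F)) ,
    g0 , bound
    where
    extension = extend-by-zero ρ (computable ρ∈𝒢)
    f = proj₁ extension
    f-comp = proj₁ (proj₂ extension)
    rest = Rel-bound L
    g = proj₁ rest
    g-comp = proj₁ (proj₂ rest)
    g0 = proj₁ (proj₂ (proj₂ rest))
    bound : ∀ {x y k} → Rel ((ρ , ρ∈𝒢) ∷ L) x y → x < k → y < sum< (suc ∘ f) k + g k
    bound {x} {k = k} (inj₁ (p , refl)) x<k =
      m≤n⇒m≤n+o (g k) (subst (_< sum< (suc ∘ f) k) (proj₂ (proj₂ extension) x p) (f≤sum< (suc ∘ f) x<k))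
    bound {k = k} (inj₂ r) x<k = m≤n⇒m≤o+n (sum< (suc ∘ f) k) (proj₂ (proj₂ (proj₂ rest)) r x<k)

  -- The relation points from the new elements into `F`, the direction used in the definition of
  -- `∂`.
  Expanding : List Element → ℕ → Set
  Expanding L K = ∀ F → Unique F → Σ[ F′ ∈ List ℕ ] Unique F′ × K * length F ≤ length F′ ×
                  (∀ {x} → x ∈ˡ F′ → ∃[ y ] y ∈ˡ F × Rel L x y)

  LargeBoundaries : List Element → ℕ → Set
  LargeBoundaries L n = ∀ F → Unique F → Σ[ D ∈ List ℕ ] Unique D × length F ≤ n * length D ×
                        (∀ {x} → x ∈ˡ D → x ∉ˡ F × ∃[ y ] y ∈ˡ F × Rel L x y)

  elements : ∀ {R} → All (_∈ 𝒢) R → List Element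
  elements = All.reduce λ {ρ} ρ∈𝒢 → ρ , ρ∈𝒢

  ∈-elements⁺ : ∀ {R} (R⊆𝒢 : All (_∈ 𝒢) R) {ρ} → ρ ∈ˡ R → Σ[ ρ∈𝒢 ∈ ρ ∈ 𝒢 ] (ρ , ρ∈𝒢) ∈ˡ elements R⊆𝒢
  ∈-elements⁺ (p ∷ ps) (here refl) = p , here refl
  ∈-elements⁺ (p ∷ ps) (there ρ∈)  = let (q , m) = ∈-elements⁺ ps ρ∈ in q , there m

  ∈-elements⁻ : ∀ {R} (R⊆𝒢 : All (_∈ 𝒢) R) {σ} → σ ∈ˡ elements R⊆𝒢 → proj₁ σ ∈ˡ R
  ∈-elements⁻ (p ∷ ps) (here refl) = here refl
  ∈-elements⁻ (p ∷ ps) (there σ∈)  = there (∈-elements⁻ ps σ∈)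

  ¬Følner⇒large-boundaries : ¬ Følner 𝒢 → Σ[ L ∈ List Element ] Σ[ n ∈ ℕ ] NonZero n × LargeBoundaries L n
  ¬Følner⇒large-boundaries ¬følner = L , suc d , _ , boundary
    where
    AlmostInvariant : List Transformation → ℕ → Set₁
    AlmostInvariant R n = Σ[ F ∈ Pred ℕ 0ℓ ] Satisfiable F × (∃[ k ] ∃[ b ] ∣ F ∣≡ k × ∣ ∂ R F ∣≡ b × n * b < k)
    Counterexample : Set (lsuc 0ℓ ⊔ ℓ)
    Counterexample = Σ[ R ∈ List Transformation ] All (_∈ 𝒢) R × Σ[ m ∈ ℕ ] ¬ AlmostInvariant R (suc m)
    counterexample : Counterexample
    -- Excluded middle turns the negated universal statement into an explicit `R` and `n` for which
    -- no set is almost invariant.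
    counterexample with lem {Counterexample}
    ... | yes c = c
    ... | no ¬c = ⊥-elim (¬følner følner)
      where
      følner : Følner 𝒢
      følner R R⊆𝒢 zero {{()}}
      følner R R⊆𝒢 (suc m) with em₁ {AlmostInvariant R (suc m)}
      ... | yes i = i
      ... | no ¬i = ⊥-elim (¬c (R , R⊆𝒢 , m , ¬i))
    R = proj₁ counterexample
    R⊆𝒢 = proj₁ (proj₂ counterexample)
    d = proj₁ (proj₂ (proj₂ counterexample))
    R± = R ++ map _⁻¹ R
    R±⊆𝒢 : All (_∈ 𝒢) R±
    R±⊆𝒢 = All.++⁺ R⊆𝒢 (All.map⁺ (All.map inverse∈ R⊆𝒢))
    -- Closing under inverses once more makes `symmetrize-sym` available, with which boundary points
    -- are bounded in terms of the points of `F`.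
    L = symmetrize (elements R±⊆𝒢)

    boundary : LargeBoundaries L (suc d)
    -- The counterexample speaks of nonempty sets only, so the empty set is treated apart.
    boundary [] u = [] , u , z≤n , λ ()
    boundary F@(x₀ ∷ _) u = D , D-unique , ≮⇒≥ large ,
      λ x∈D → let (x∉F , y , y∈F , r) = ∈D⇒ x∈D in x∉F , y , y∈F , Rel-++ˡ _ r
      where
      E = elements R±⊆𝒢
      Boundary : ℕ → Set
      Boundary x = x ∉ˡ F × ∃[ y ] y ∈ˡ F × Rel E x y
      Boundary? : Decidable Boundary
      Boundary? _ = em
      g = proj₁ (Rel-bound L)
      bounded = proj₂ (proj₂ (proj₂ (Rel-bound L)))
      k = proj₁ (upper-bound F)
      D = filter Boundary? (upTo (g k))
      D-unique = Unique.filter⁺ Boundary? (Unique.upTo⁺ (g k))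
      ∈D⇒ : ∀ {x} → x ∈ˡ D → Boundary x
      ∈D⇒ x∈ = proj₂ (∈-filter⁻ Boundary? {xs = upTo (g k)} x∈)
      ⇒∈D : ∀ {x} → Boundary x → x ∈ˡ D
      ⇒∈D b@(_ , y , y∈F , r) = ∈-filter⁺ Boundary?
        (∈-upTo⁺ (bounded (symmetrize-sym E (Rel-++ˡ E r)) (proj₂ (upper-bound F) y∈F))) b
      sound : ∀ {x} → Boundary x → x ∈ ∂ R (_∈ˡ F)
      sound (x∉F , y , y∈F , r) = let (σ , σ∈ , p , eq) = Rel⁻ E r in
        x∉F , proj₁ σ , ∈-elements⁻ R±⊆𝒢 σ∈ , p , subst (_∈ˡ F) (sym eq) y∈F
      complete : ∀ {x} → x ∈ ∂ R (_∈ˡ F) → Boundary x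
      complete (x∉F , ρ , ρ∈ , p , y∈F) =
        x∉F , _ , y∈F , Rel⁺ (proj₂ (∈-elements⁺ R±⊆𝒢 ρ∈)) (p , refl)
      large : ¬ (suc d * length D < length F)
      large small = proj₂ (proj₂ (proj₂ counterexample))
        ( (_∈ˡ F) , (x₀ , here refl) , length F , length D
        , enumeration⇒∣∣≡ u id id , enumeration⇒∣∣≡ D-unique (sound ∘ ∈D⇒) (⇒∈D ∘ complete) , small)

  -- Each step adds at least ∣F∣/n new points, so 3n steps reach 4∣F∣.
  large-boundaries⇒expanding : ∀ {L₀ n} → .{{NonZero n}} → LargeBoundaries L₀ n → ∃[ L ] Expanding L 4
  large-boundaries⇒expanding {L₀} {n} boundary = proj₁ (steps (3 * n)) , expanding
    where
    Grows : List Element → ℕ → Set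
    Grows L j = ∀ F → Unique F → Σ[ F′ ∈ List ℕ ] Unique F′ ×
                length F ≤ length F′ × (n + j) * length F ≤ n * length F′ ×
                (∀ {x} → x ∈ˡ F′ → ∃[ y ] y ∈ˡ F × Rel L x y)
    steps : ∀ j → ∃[ L ] Grows L j
    steps zero = (identity , identity∈) ∷ [] , λ F u →
      F , u , ≤-refl , ≤-reflexive (cong (_* length F) (+-identityʳ n)) , λ {x} x∈ → x , x∈ , inj₁ (_ , refl)
    steps (suc j) = let (L , grow) = steps j in L ++ cartesianProductWith compose L₀ L , λ F u →
      let (F′ , u′ , F≤F′ , grown , rel) = grow F u ; (D , D-unique , F′≤nD , D-rel) = boundary F′ u′ in
      F′ ++ D , Unique.++⁺ u′ D-unique (λ (x∈F′ , x∈D) → proj₁ (D-rel x∈D) x∈F′) ,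
      ≤-trans F≤F′ (≤-trans (m≤m+n _ _) (≤-reflexive (sym (length-++ F′)))) ,
      (begin
        (n + suc j) * length F              ≡⟨ cong (_* length F) (+-suc n j) ⟩
        length F + (n + j) * length F       ≤⟨ +-mono-≤ (≤-trans F≤F′ F′≤nD) grown ⟩
        n * length D + n * length F′        ≡⟨ +-comm (n * length D) _ ⟩
        n * length F′ + n * length D        ≡⟨ *-distribˡ-+ n (length F′) (length D) ⟨
        n * (length F′ + length D)          ≡⟨ cong (n *_) (length-++ F′) ⟨
        n * length (F′ ++ D)                ∎) ,
      λ x∈ → [ (λ x∈F′ → let (y , y∈F , r) = rel x∈F′ in y , y∈F , Rel-++ˡ L r)
             , (λ x∈D → let (_ , y , y∈F′ , r) = D-rel x∈D ; (z , z∈F , r′) = rel y∈F′ in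
                        z , z∈F , Rel-++ʳ L (Rel-compose L₀ L r r′)) ]′ (∈-++⁻ F′ x∈)
      where open ≤-Reasoning
    expanding : Expanding (proj₁ (steps (3 * n))) 4
    expanding F u = let (F′ , u′ , _ , grown , rel) = proj₂ (steps (3 * n)) F u in
      F′ , u′ ,
      -- The factor `n + 3 * n` in `grown` is `4 * n` by definition, and `n` cancels.
      *-cancelˡ-≤ n (≤-trans (≤-reflexive (trans (sym (*-assoc n 4 (length F))) (cong (_* length F) (*-comm n 4)))) grown) ,
      rel

-- Perfect matchings of expanding graphs

module PerfectMatching
  (em : {A : Set} → Dec A)
  (_~_ : ℕ → ℕ → Set) (~-decC : DecC₂ _~_) (~-sym : ∀ {u v} → u ~ v → v ~ u)
  (color : ℕ → Bool) (~-color : ∀ {u v} → u ~ v → color u ≢ color v)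
  (g : ℕ → ℕ) (g-comp : Comp₁ g) (g₀ : g 0 ≡ 0) (k≤g : ∀ k → k ≤ g k)
  (~-bound : ∀ {u v k} → u ~ v → u < k → v < g k)
  (expand : ∀ b S → Unique S → All (λ s → color s ≡ b) S →
            Σ[ T ∈ List ℕ ] Unique T × 2 * length S ≤ length T ×
            (∀ {t} → t ∈ˡ T → ∃[ s ] s ∈ˡ S × s ~ t))
  where
  open Extension em _~_ ~-sym color ~-color g k≤g ~-bound expand
  open GreedyMatching _~_ ~-decC

  horizon-comp : Comp₁ horizon
  horizon-comp = ap₂ (λ i n → layer n i)
    (comp-ext (λ { (i ∷ n ∷ []) → refl })
      (rec {h = λ i xs → layer (lookup xs 0F) i} (ap₁ g g-comp (var 0F)) (ap₁ g g-comp (ap₁ g g-comp (var 1F)))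
           (λ _ → refl) (λ _ _ → refl)))
    (ap₂ _*_ *-comp (const-comp 2) (var 0F)) (var 0F)

  open Computation horizon horizon-comp g₀ n≤horizon extend

  abstract
    perfect-matching : Σ[ μ ∈ (ℕ → ℕ) ] Comp₁ μ × (∀ i → i ~ μ i) × (∀ i → μ (μ i) ≡ i)
    perfect-matching = matching , matching-comp , matching-edge , matching-involutive

-- A vertex v stands for the number v / 3: as a source if v % 3 is 2, and as one of the two
-- copies of a target otherwise.
vertex-% : ∀ {t} x → t < 3 → (t + x * 3) % 3 ≡ t
vertex-% {t} x t<3 = trans ([m+kn]%n≡m%n t x 3) (m<n⇒m%n≡m t<3)

vertex-/ : ∀ {t} x → t < 3 → (t + x * 3) / 3 ≡ x
vertex-/ {t} x t<3 = trans (+-distrib-/-∣ʳ t (divides-refl x)) (cong₂ _+_ (m<n⇒m/n≡0 t<3) (m*n/n≡m x 3))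

vertex-η : ∀ {t} v → v % 3 ≡ t → v ≡ t + v / 3 * 3
vertex-η v refl = m≡m%n+[m/n]*n v 3

<-[1+/3]*3 : ∀ v → v < suc (v / 3) * 3
<-[1+/3]*3 v = subst (_< suc (v / 3) * 3) (sym (m≡m%n+[m/n]*n v 3)) (+-monoˡ-< (v / 3 * 3) (m%n<n v 3))

abstract
  /3-comp : Comp₁ (_/ 3)
  /3-comp = comp-ext (λ { (v ∷ []) → ≤-antisym (≮⇒≥ λ lt → minimal (v ∷ []) (v / 3) lt (<-[1+/3]*3 v))
                                                (≮⇒≥ λ lt → <⇒≱ (holds (v ∷ [])) (≤-trans (*-monoˡ-≤ 3 lt) (m/n*n≤m v 3))) })
                     (proj₁ (proj₂ found))
    where
    Bound : Vec ℕ 2 → Set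
    Bound w = lookup w 1F < suc (lookup w 0F) * 3
    found : Σ[ h ∈ (Vec ℕ 1 → ℕ) ] Comp h × (∀ xs → Bound (h xs ∷ xs)) × (∀ xs z → z < h xs → ¬ Bound (z ∷ xs))
    found = search {n = 1} {P = Bound} (var 1F <ᶜ ap₂ _*_ *-comp (ap₁ suc suc-comp (var 0F)) (const-comp 3))
                   λ xs → lookup xs 0F / 3 , <-[1+/3]*3 (lookup xs 0F)
    holds : ∀ xs → Bound (proj₁ found xs ∷ xs)
    holds = proj₁ (proj₂ (proj₂ found))
    minimal : ∀ xs z → z < proj₁ found xs → ¬ Bound (z ∷ xs)
    minimal = proj₂ (proj₂ (proj₂ found))

  %3-comp : Comp₁ (_% 3)
  %3-comp = comp-ext
    (λ { (v ∷ []) → trans (cong (_∸ v / 3 * 3) (m≡m%n+[m/n]*n v 3)) (m+n∸n≡m (v % 3) (v / 3 * 3)) })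
    (ap₂ _∸_ ∸-comp (var 0F) (ap₂ _*_ *-comp (ap₁ (_/ 3) /3-comp (var 0F)) (const-comp 3)))

Source : Pred ℕ 0ℓ
Source v = v % 3 ≡ 2

Source-decC : DecC₁ Source
Source-decC = ap₁ (_% 3) %3-comp (var 0F) ≡ᶜ const-comp 2

color : ℕ → Bool
color v = does (v % 3 ≟ 2)

color≡true⇒Source : ∀ v → color v ≡ true → Source v
color≡true⇒Source v eq with v % 3 ≟ 2
... | yes s = s
... | no ¬s with () ← trans (sym eq) (dec-false (v % 3 ≟ 2) ¬s)

color≡false⇒¬Source : ∀ v → color v ≡ false → ¬ Source v
color≡false⇒¬Source v eq s with () ← trans (sym eq) (dec-true (v % 3 ≟ 2) s)

¬Source⇒%3<2 : ∀ v → ¬ Source v → v % 3 < 2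
¬Source⇒%3<2 v ¬s = ≤∧≢⇒< (≤-pred (m%n<n v 3)) ¬s

target-¬Source : ∀ {t} x → t < 2 → ¬ Source (t + x * 3)
target-¬Source x t<2 s = <⇒≢ t<2 (trans (sym (vertex-% x (m<n⇒m<1+n t<2))) s)

Opposite : ℕ → ℕ → Set
Opposite u v = (Source u × ¬ Source v) ⊎ (¬ Source u × Source v)

-- The paradoxical decomposition

module Paradox {ℓ} (lem : ExcludedMiddle (lsuc 0ℓ ⊔ ℓ))
               (𝒢 : Pred Transformation ℓ) (pg : IsPseudogroupOfComputableTransformations 𝒢)
               (L₀ : List (Pseudogroup.Element 𝒢 pg)) (expanding : Growth.Expanding lem 𝒢 pg L₀ 4) where
  open IsPseudogroupOfComputableTransformations pg
  open Pseudogroup 𝒢 pg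
  open Growth lem 𝒢 pg

  L = symmetrize L₀

  infix 4 _~_
  record _~_ (u v : ℕ) : Set where
    constructor edge
    field
      opposite : Opposite u v
      related  : Rel L (u / 3) (v / 3)
  open _~_

  ~-decC : DecC₂ _~_
  ~-decC = decC-ext (λ _ (o , r) → edge o r) (λ _ e → opposite e , related e)
    (((source (var 0F) ×ᶜ ¬ᶜ source (var 1F)) ⊎ᶜ (¬ᶜ source (var 0F) ×ᶜ source (var 1F))) ×ᶜ
    decC-ap₂ (Rel L) (Rel-decC L) (ap₁ (_/ 3) /3-comp (var 0F)) (ap₁ (_/ 3) /3-comp (var 1F)))
    where
    source : ∀ {n} {g : Vec ℕ n → ℕ} → Comp g → DecC λ xs → Source (g xs)
    source = decC-ap₁ Source Source-decC

  ~-sym : ∀ {u v} → u ~ v → v ~ u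
  ~-sym (edge o r) = edge ([ (λ (s , ¬s) → inj₂ (¬s , s)) , (λ (¬s , s) → inj₁ (s , ¬s)) ]′ o) (symmetrize-sym L₀ r)

  ~-color : ∀ {u v} → u ~ v → color u ≢ color v
  ~-color {u} {v} (edge (inj₁ (s , ¬s)) _) eq = ¬s (color≡true⇒Source v (trans (sym eq) (dec-true (u % 3 ≟ 2) s)))
  ~-color {u} {v} (edge (inj₂ (¬s , s)) _) eq = ¬s (color≡true⇒Source u (trans eq (dec-true (v % 3 ≟ 2) s)))

  -- The factor 3 turns a bound on numbers into one on the vertices that stand for them, and the
  -- summand `k` ensures that `g` dominates the identity.
  g : ℕ → ℕ
  g k = k + proj₁ (Rel-bound L) k * 3

  g-comp : Comp₁ g
  g-comp = ap₂ _+_ +-comp (var 0F) (ap₂ _*_ *-comp (ap₁ (proj₁ (Rel-bound L)) (proj₁ (proj₂ (Rel-bound L))) (var 0F)) (const-comp 3))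

  ~-bound : ∀ {u v k} → u ~ v → u < k → v < g k
  ~-bound {u} {v} {k} (edge _ r) u<k = begin-strict
    v                              <⟨ <-[1+/3]*3 v ⟩
    suc (v / 3) * 3                ≤⟨ *-monoˡ-≤ 3 (proj₂ (proj₂ (proj₂ (Rel-bound L))) r (≤-<-trans (m/n≤m u 3) u<k)) ⟩
    proj₁ (Rel-bound L) k * 3      ≤⟨ m≤n+m _ k ⟩
    g k                            ∎
    where open ≤-Reasoning

  vertices-unique : ∀ t {xs} → Unique xs → Unique (map (λ x → t + x * 3) xs)
  vertices-unique t = Unique.map⁺ λ {x} {y} eq → *-cancelʳ-≡ x y 3 (+-cancelˡ-≡ t _ _ eq)

  -- Distinct sources stand for distinct numbers, so one copy of each related target already gives a
  -- factor 4. Two targets may stand for the same number, which halves the factor 4 to the required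
  -- 2.
  expand : ∀ b S → Unique S → All (λ s → color s ≡ b) S →
           Σ[ T ∈ List ℕ ] Unique T × 2 * length S ≤ length T × (∀ {t} → t ∈ˡ T → ∃[ s ] s ∈ˡ S × s ~ t)
  expand true S S-unique S-sources = T , vertices-unique 0 F′-unique , 2S≤T , T~S
    where
    source : ∀ {s} → s ∈ˡ S → Source s
    source {s} s∈ = color≡true⇒Source s (All.lookup S-sources s∈)
    expansion = expanding (map (_/ 3) S) (map-unique
      (λ {x} {y} x∈ y∈ eq → trans (vertex-η x (source x∈)) (trans (cong (λ k → 2 + k * 3) eq) (sym (vertex-η y (source y∈)))))
      S-unique)
    F′ = proj₁ expansion
    F′-unique = proj₁ (proj₂ expansion)
    T = map (λ x → 0 + x * 3) F′
    2S≤T : 2 * length S ≤ length T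
    2S≤T = begin
      2 * length S                    ≤⟨ *-monoˡ-≤ (length S) {2} {4} (s≤s (s≤s z≤n)) ⟩
      4 * length S                    ≡⟨ cong (4 *_) (length-map (_/ 3) S) ⟨
      4 * length (map (_/ 3) S)       ≤⟨ proj₁ (proj₂ (proj₂ expansion)) ⟩
      length F′                       ≡⟨ length-map _ F′ ⟨
      length T                        ∎
      where open ≤-Reasoning
    T~S : ∀ {t} → t ∈ˡ T → ∃[ s ] s ∈ˡ S × s ~ t
    T~S t∈ with ∈-map⁻ _ t∈
    ... | x , x∈ , refl with proj₂ (proj₂ (proj₂ expansion)) x∈
    ...   | y , y∈ , r with ∈-map⁻ (_/ 3) y∈
    ...     | s , s∈ , refl = s , s∈ , edge (inj₁ (source s∈ , target-¬Source {0} x z<s))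
              (subst (Rel L (s / 3)) (sym (vertex-/ {0} x z<s)) (symmetrize-sym L₀ (Rel-++ˡ L₀ r)))
  expand false S S-unique S-targets = T , vertices-unique 2 F′-unique , 2S≤T , T~S
    where
    target : ∀ {s} → s ∈ˡ S → ¬ Source s
    target {s} s∈ = color≡false⇒¬Source s (All.lookup S-targets s∈)
    F = deduplicate _≟_ (map (_/ 3) S)
    expansion = expanding F (deduplicate-! (map (_/ 3) S))
    F′ = proj₁ expansion
    F′-unique = proj₁ (proj₂ expansion)
    T = map (λ x → 2 + x * 3) F′
    Fs = map (λ x → 0 + x * 3) F ++ map (λ x → 1 + x * 3) F
    S⊆Fs : ∀ {s} → s ∈ˡ S → s ∈ˡ Fs
    S⊆Fs {s} s∈ with s % 3 in eq | ¬Source⇒%3<2 s (target s∈)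
    ... | 0 | _ = subst (_∈ˡ Fs) (sym (vertex-η s eq)) (∈-++⁺ˡ (∈-map⁺ _ (∈-deduplicate⁺ _≟_ (∈-map⁺ (_/ 3) s∈))))
    ... | 1 | _ = subst (_∈ˡ Fs) (sym (vertex-η s eq)) (∈-++⁺ʳ _ (∈-map⁺ _ (∈-deduplicate⁺ _≟_ (∈-map⁺ (_/ 3) s∈))))
    ... | suc (suc _) | s≤s (s≤s ())
    length-Fs : length Fs ≡ 2 * length F
    length-Fs = trans (length-++ (map (λ x → 0 + x * 3) F))
      (cong₂ _+_ (length-map _ F) (trans (length-map _ F) (sym (+-identityʳ (length F)))))
    2S≤T : 2 * length S ≤ length T
    2S≤T = begin
      2 * length S                    ≤⟨ *-monoʳ-≤ 2 (unique-⊆⇒length≤ S-unique S⊆Fs) ⟩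
      2 * length Fs                   ≡⟨ cong (2 *_) length-Fs ⟩
      2 * (2 * length F)              ≡⟨ *-assoc 2 2 (length F) ⟨
      4 * length F                    ≤⟨ proj₁ (proj₂ (proj₂ expansion)) ⟩
      length F′                       ≡⟨ length-map _ F′ ⟨
      length T                        ∎
      where open ≤-Reasoning
    T~S : ∀ {t} → t ∈ˡ T → ∃[ s ] s ∈ˡ S × s ~ t
    T~S t∈ with ∈-map⁻ _ t∈
    ... | x , x∈ , refl with proj₂ (proj₂ (proj₂ expansion)) x∈
    ...   | y , y∈ , r with ∈-map⁻ (_/ 3) (∈-deduplicate⁻ _≟_ (map (_/ 3) S) y∈)
    ...     | s , s∈ , refl = s , s∈ , edge (inj₂ (target s∈ , vertex-% x (n<1+n 2)))
              (subst (Rel L (s / 3)) (sym (vertex-/ x (n<1+n 2))) (symmetrize-sym L₀ (Rel-++ˡ L₀ r)))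

  module Perfect = PerfectMatching em _~_ ~-decC ~-sym color ~-color
    g g-comp (cong (_* 3) (proj₁ (proj₂ (proj₂ (Rel-bound L))))) (λ k → m≤m+n k _) ~-bound expand

  abstract
    matching : ℕ → ℕ
    matching = proj₁ Perfect.perfect-matching

    matching-comp : Comp₁ matching
    matching-comp = proj₁ (proj₂ Perfect.perfect-matching)

    matching-edge : ∀ i → i ~ matching i
    matching-edge = proj₁ (proj₂ (proj₂ Perfect.perfect-matching))

    matching-involutive : ∀ i → matching (matching i) ≡ i
    matching-involutive = proj₂ (proj₂ (proj₂ Perfect.perfect-matching))

  partner : ℕ → ℕ
  partner x = matching (2 + x * 3)

  partner-comp : Comp₁ partner
  partner-comp = ap₁ matching matching-comp
    (ap₁ (2 +_) (ap₁ suc suc-comp (ap₁ suc suc-comp (var 0F))) (ap₂ _*_ *-comp (var 0F) (const-comp 3)))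

  target-of : ℕ → ℕ
  target-of x = partner x / 3

  target-of-comp : Comp₁ target-of
  target-of-comp = ap₁ (_/ 3) /3-comp (ap₁ partner partner-comp (var 0F))

  partner-¬Source : ∀ x → ¬ Source (partner x)
  partner-¬Source x with opposite (matching-edge (2 + x * 3))
  ... | inj₁ (_ , ¬s) = ¬s
  ... | inj₂ (¬s , _) = ⊥-elim (¬s (vertex-% x (n<1+n 2)))

  target-of-Rel : ∀ x → Rel L x (target-of x)
  target-of-Rel x = subst (λ k → Rel L k (target-of x)) (vertex-/ x (n<1+n 2)) (related (matching-edge (2 + x * 3)))

  -- A number is classified by the copy of its target with which its source vertex is matched. Every
  -- target has both copies matched, so each class is mapped onto all of `ℕ`.
  X : ℕ → Pred ℕ 0ℓ
  X t x = partner x % 3 ≡ t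

  X-computable : ∀ t → ComputableSet (X t)
  X-computable t = decC⇒ComputableSet (ap₁ (_% 3) %3-comp (ap₁ partner partner-comp (var 0F)) ≡ᶜ const-comp t)

  module _ {t} (t<2 : t < 2) where

    source-of : ℕ → ℕ
    source-of y = matching (t + y * 3) / 3

    partner-source-of : ∀ y → partner (source-of y) ≡ t + y * 3
    partner-source-of y = trans (cong matching (sym (vertex-η _ is-source))) (matching-involutive (t + y * 3))
      where
      is-source : Source (matching (t + y * 3))
      is-source with opposite (matching-edge (t + y * 3))
      ... | inj₁ (s , _) = ⊥-elim (target-¬Source y t<2 s)
      ... | inj₂ (_ , s) = s

    source-of∈X : ∀ y → source-of y ∈ X t
    source-of∈X y = trans (cong (_% 3) (partner-source-of y)) (vertex-% y (m<n⇒m<1+n t<2))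

    target-of-source-of : ∀ y → target-of (source-of y) ≡ y
    target-of-source-of y = trans (cong (_/ 3) (partner-source-of y)) (vertex-/ y (m<n⇒m<1+n t<2))

    -- The index `t` of the copy and the number `target-of x` determine the vertex `partner x`, and
    -- the matching is an involution.
    target-of-injective : ∀ {x y} → x ∈ X t → y ∈ X t → target-of x ≡ target-of y → x ≡ y
    target-of-injective {x} {y} x∈ y∈ eq = *-cancelʳ-≡ x y 3 (+-cancelˡ-≡ 2 _ _ (begin
      2 + x * 3                        ≡⟨ matching-involutive (2 + x * 3) ⟨
      matching (partner x)             ≡⟨ cong matching (vertex-η (partner x) x∈) ⟩
      matching (t + target-of x * 3)   ≡⟨ cong (λ k → matching (t + k * 3)) eq ⟩
      matching (t + target-of y * 3)   ≡⟨ cong matching (vertex-η (partner y) y∈) ⟨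
      matching (partner y)             ≡⟨ matching-involutive (2 + y * 3) ⟩
      2 + y * 3                        ∎))
      where open ≡-Reasoning

    γ : Bijection ⟪ X t ⟫ ⟪ U ⟫
    γ = record
      { to = λ (x , _) → target-of x , tt
      ; cong = cong target-of
      ; bijective = (λ { {_ , x∈} {_ , y∈} → target-of-injective x∈ y∈ }) ,
                    λ (y , _) → (source-of y , source-of∈X y) , λ { refl → target-of-source-of y }
      }

    γ∈𝒢 : mk γ ∈ 𝒢
    γ∈𝒢 = piecewise∈ L (mk γ) (X-computable t) target-of target-of-comp (λ _ _ → refl) λ x _ → target-of-Rel x

  decomposition : EffectiveParadoxicalDecomposition 𝒢
  decomposition = record
    { X₁ = X 0 ; X₂ = X 1
    ; covers = covers
    ; disjoint = λ (x∈X₀ , x∈X₁) → 0≢1+n (trans (sym x∈X₀) x∈X₁)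
    ; nonempty₁ = source-of {0} z<s 0 , source-of∈X z<s 0
    ; nonempty₂ = source-of {1} (s<s z<s) 0 , source-of∈X (s<s z<s) 0
    ; X₁-computable = X-computable 0 ; X₂-computable = X-computable 1
    ; γ₁ = γ z<s ; γ₂ = γ (s<s z<s)
    ; γ₁∈𝒢 = γ∈𝒢 z<s ; γ₂∈𝒢 = γ∈𝒢 (s<s z<s)
    ; γ₁-computable = computable (γ∈𝒢 z<s) ; γ₂-computable = computable (γ∈𝒢 (s<s z<s))
    }
    where
    covers : ∀ x → X 0 x ⊎ X 1 x
    covers x with partner x % 3 | ¬Source⇒%3<2 (partner x) (partner-¬Source x)
    ... | 0 | _ = inj₁ refl
    ... | 1 | _ = inj₂ refl
    ... | suc (suc _) | s≤s (s≤s ())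

theorem3p2 : ∀ {ℓ} → ExcludedMiddle (lsuc 0ℓ ⊔ ℓ) →
    (𝒢 : Pred Transformation ℓ) →
    IsPseudogroupOfComputableTransformations 𝒢 →
    ¬ Følner 𝒢 →
    EffectiveParadoxicalDecomposition 𝒢
theorem3p2 lem 𝒢 pg ¬følner =
  let (L₀ , n , n≢0 , boundary) = Growth.¬Følner⇒large-boundaries lem 𝒢 pg ¬følner
      (L , expanding) = Growth.large-boundaries⇒expanding lem 𝒢 pg {{n≢0}} boundary
  in Paradox.decomposition lem 𝒢 pg L expanding
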